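{- Suppose $A$ is a finite set of real numbers such that $|\Delta(A\times A)|=O(|A|^2)$. Then there is a non-trivial line in $\mathbb{R}^2$ (in fact, there are many such lines) which contains $\Omega(|A|^{1/8})$ points of $A\times A$.
   Context: For a finite set of points $P\subset\mathbb{R}^2$, the set of (squared) distances spanned by $P$ is \[\Delta(P)=\{(p_1-q_1)^2+(p_2-q_2)^2:(p_1,p_2),(q_1,q_2)\in P\}.\] A line in $\mathbb{R}^2$ is called non-trivial if it is not parallel to either coordinate axis and is not the main diagonal $\{(x,y):y=x\}$. $|\cdot|$ denotes cardinality. The constant implied by $\Omega$ may depend on the constant implied by $O$ in the hypothesis. The number of lines meant by "many" is not quantified. -}

module Defs where

open import Algebra.Bundles using (CommutativeRing)
open import Data.List.Base using (List; length; filter; deduplicate; cartesianProduct; cartesianProductWith)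
open import Data.Nat.Base using (ℕ)
open import Data.Product.Base using (_×_; _,_; ∃; ∃-syntax)
open import Level using (Level; _⊔_; suc)
open import Relation.Binary.Core using (Rel)
open import Relation.Binary.Structures using (IsStrictTotalOrder)
open import Relation.Nullary.Negation.Core using (¬_)
open import Relation.Unary using (Pred; Satisfiable; Decidable; _≐_)
import Data.List.Relation.Unary.Unique.Setoid as SetoidUnique

-- The real numbers, given by their characterisation up to isomorphism as the
-- Dedekind-complete (linearly) ordered field.  As in classical mathematics the
-- order is trichotomous, hence equality and order are decidable; this is what
-- makes cardinalities of finite sets of reals meaningful.
record Reals (c ℓ₁ ℓ₂ : Level) : Set (suc (c ⊔ ℓ₁ ⊔ ℓ₂)) where
  infix 4 _<_ _≤_
  field
    commutativeRing : CommutativeRing c ℓ₁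

  open CommutativeRing commutativeRing public

  field
    _<_                : Rel Carrier ℓ₂
    isStrictTotalOrder : IsStrictTotalOrder _≈_ _<_
    0≉1                : 0# ≉ 1#
    inverse            : ∀ {x} → x ≉ 0# → ∃[ y ] x * y ≈ 1#
    +-monoˡ-<          : ∀ z {x y} → x < y → x + z < y + z
    *-pos              : ∀ {x y} → 0# < x → 0# < y → 0# < x * y

  _≤_ : Rel Carrier ℓ₂
  x ≤ y = ¬ (y < x)

  UpperBound : ∀ {p} → Pred Carrier p → Pred Carrier (c ⊔ ℓ₂ ⊔ p)
  UpperBound P b = ∀ {x} → P x → x ≤ b

  field
    supremum : (P : Pred Carrier (c ⊔ ℓ₁ ⊔ ℓ₂)) →
               Satisfiable P → Satisfiable (UpperBound P) →
               ∃[ s ] (UpperBound P s × (∀ {b} → UpperBound P b → s ≤ b))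

  open IsStrictTotalOrder isStrictTotalOrder public
    using (compare; _≟_; _<?_)

module Plane {c ℓ₁ ℓ₂} (ℝ : Reals c ℓ₁ ℓ₂) where
  open Reals ℝ

  Point : Set c
  Point = Carrier × Carrier

  -- Finite sets of reals are duplicate-free lists; the cardinality is then the
  -- length.
  open SetoidUnique setoid public using (Unique)

  sqDist : Point → Point → Carrier
  sqDist (p₁ , p₂) (q₁ , q₂) =
    (p₁ - q₁) * (p₁ - q₁) + (p₂ - q₂) * (p₂ - q₂)

  -- Δ(P), listed without repetitions, so that |Δ(P)| is its length.
  Δ : List Point → List Carrier
  Δ P = deduplicate _≟_ (cartesianProductWith sqDist P P)

  -- The line a x + b y = d.
  record Line : Set (c ⊔ ℓ₁) where
    field
      a b d         : Carrier
      nondegenerate : ¬ (a ≈ 0# × b ≈ 0#)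

  On : Line → Pred Point ℓ₁
  On l (x , y) = a * x + b * y ≈ d
    where open Line l

  on? : ∀ l → Decidable (On l)
  on? l (x , y) = (a * x + b * y) ≟ d
    where open Line l

  ParallelToXAxis ParallelToYAxis : Pred Line ℓ₁
  ParallelToXAxis l = Line.a l ≈ 0#
  ParallelToYAxis l = Line.b l ≈ 0#

  Diagonal : Pred Point ℓ₁
  Diagonal (x , y) = y ≈ x

  -- The same line may have many equations, so lines are compared as sets of
  -- points.
  SameLine : Rel Line (c ⊔ ℓ₁)
  SameLine l m = On l ≐ On m

  Distinct : Rel Line (c ⊔ ℓ₁)
  Distinct l m = ¬ SameLine l m

  NonTrivial : Pred Line (c ⊔ ℓ₁)
  NonTrivial l =
    ¬ ParallelToXAxis l × ¬ ParallelToYAxis l × ¬ (On l ≐ Diagonal)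

  -- |l ∩ (A × A)|, for A without repetitions.
  incidences : Line → List Carrier → ℕ
  incidences l A = length (filter (on? l) (cartesianProduct A A))

{-# OPTIONS --safe #-}
module Submission where

-- Write n = |A|, D = (A - A)² and S = |Δ(A × A)| = |D + D|.  Since
--   (b - x)² + (a - y)² - (a - x)² - (b - y)² = 2 (a - b) (x - y),
-- twice a product of two differences lies in (D + D) - (D + D), so by the
-- inequalities of Petridis and Ruzsa |D D| |D|³ ≤ S⁴.  On the other hand
-- Solymosi's argument (sums of points of D × D on consecutive lines through the
-- origin are distinct) gives |D|⁶ ≤ 10 |D D|³ |D + D|².  Hence |D|¹⁵ ≪ S¹⁴, which
-- for S ≪ n² yields |A - A|⁸ ≪ n¹⁵.  The |A - A| lines x - y = d cover A × A, so
-- they contain n² / |A - A| ≫ n^(1/8) points on average; as each contains at most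
-- n points, at least n / 2 of them are that rich.

open import Defs
open import Algebra.Bundles using (AbelianGroup)
open import Data.Bool.Base using (Bool; true; false)
open import Data.Empty using (⊥; ⊥-elim)
open import Data.List.Base using (List; []; _∷_; _++_; length; filter; map; cartesianProduct; cartesianProductWith; deduplicate)
open import Data.List.Properties using (length-++; length-map; length-filter; filter-some)
open import Data.List.Relation.Unary.All as All using (All; []; _∷_)
open import Data.List.Relation.Unary.AllPairs as AllPairs using (AllPairs; []; _∷_)
open import Data.List.Relation.Unary.Any as Any using (Any; here; there; _─_)
open import Data.Nat.Base as ℕ using (ℕ; zero; suc; _+_; _*_; _^_; _≤_; _<_; z≤n; s≤s; NonZero)
open import Data.Nat.Induction using (<-wellFounded; Acc; acc)
open import Data.Nat.ListAction using (sum)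
open import Data.Nat.Tactic.RingSolver using (solve-∀)
open import Data.Product.Base using (_×_; _,_; ∃-syntax; proj₁; proj₂)
open import Data.Sum.Base using (_⊎_; inj₁; inj₂; [_,_]′)
open import Function.Base using (_∘_; id)
open import Level using (Level)
open import Relation.Binary.Bundles using (Setoid; DecSetoid)
open import Relation.Binary.Definitions using (tri<; tri≈; tri>)
open import Relation.Binary.PropositionalEquality as ≡ using (_≡_)
open import Relation.Binary.Structures using (IsStrictTotalOrder)
open import Relation.Nullary using (¬_; Dec; yes; no; does)
open import Relation.Nullary.Decidable using (¬?; _×-dec_; decidable-stable)
open import Relation.Nullary.Negation using (contradiction)
open import Relation.Unary using (Pred; Decidable; _∩_)
import Algebra.Properties.Ring as RingProperties
import Algebra.Solver.Ring.NaturalCoefficients.Default as SemiringSolver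
import Data.List.Membership.DecSetoid as MembershipDec
import Data.List.Membership.Setoid as SetoidMembership
import Data.List.Membership.Setoid.Properties as Membership
import Data.List.Relation.Unary.All.Properties as All
import Data.List.Relation.Unary.AllPairs.Properties as AllPairs
import Data.List.Relation.Unary.Any.Properties as Any
import Data.List.Relation.Unary.Unique.DecSetoid.Properties as UniqueDec
import Data.List.Relation.Unary.Unique.Setoid as SetoidUnique
import Data.List.Relation.Unary.Unique.Setoid.Properties as Unique
import Data.Nat.Properties as ℕ
import Data.Product.Relation.Binary.Pointwise.NonDependent as Pointwise
import Relation.Binary.Definitions as B

-- Squares of differences are constrained twice over. Their pairwise sums are squared distances, so
-- few distances mean small additive growth; and a product of two of them is the square of a product
-- of two differences, which the displayed identity ties back to sums of squares. If |D| were close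
-- to S, both the sumset and the product set of D would be small, which Solymosi's bound forbids.
-- Balancing the two inequalities pushes |D| down to the order of S^(14/15), i.e. n^(28/15), and
-- 28/15 lies just below the 15/8 that the exponent 1/8 requires. Comparing every line through the
-- origin with one reference line, and keeping those above half the average, avoids the logarithm of
-- a dyadic decomposition. Since cardinalities are natural numbers, the estimates are stated with
-- denominators and roots cleared.

private variable
  a b p q r ℓ : Level
  A : Set a
  B : Set b

-- Counting and sums over lists.

count : {P : Pred A p} → Decidable P → List A → ℕ
count P? xs = length (filter P? xs)

∑ : List A → (A → ℕ) → ℕ
∑ xs f = sum (map f xs)

∑-mono : ∀ {f g : A → ℕ} {xs} → All (λ x → f x ≤ g x) xs → ∑ xs f ≤ ∑ xs g
∑-mono []       = z≤n
∑-mono (p ∷ ps) = ℕ.+-mono-≤ p (∑-mono ps)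

∑-const : ∀ (xs : List A) k → ∑ xs (λ _ → k) ≡ length xs * k
∑-const []       k = ≡.refl
∑-const (x ∷ xs) k = ≡.cong (k +_) (∑-const xs k)

∑-≤-const : ∀ {xs : List A} {f k} → All (λ x → f x ≤ k) xs → ∑ xs f ≤ length xs * k
∑-≤-const {xs = xs} {k = k} ps = ℕ.≤-trans (∑-mono ps) (ℕ.≤-reflexive (∑-const xs k))

-- Exchange of the order of summation over the pairs in `R`. The weight is general because the
-- energy estimate takes `f` to be the counting function itself, which produces a sum of squares.
∑-filter : {R : A → B → Set r} (R? : ∀ x → Decidable (R x)) (f : B → ℕ) (xs : List A) (ys : List B) →
           ∑ xs (λ x → ∑ (filter (R? x) ys) f) ≡ ∑ ys (λ y → count (λ x → R? x y) xs * f y)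
∑-filter R? f []       ys = ≡.sym (≡.trans (∑-const ys 0) (ℕ.*-zeroʳ (length ys)))
∑-filter {A = A} {B = B} R? f (x ∷ xs) ys = ≡.trans (≡.cong (∑ (filter (R? x) ys) f +_) (∑-filter R? f xs ys)) (step ys)
  where
  weight : List A → B → ℕ
  weight zs y = count (λ x → R? x y) zs * f y

  lem₁ : ∀ i j k l → i + j + (k * i + l) ≡ i + k * i + (j + l)
  lem₁ = solve-∀

  lem₂ : ∀ i j k → i + (j + k) ≡ j + (i + k)
  lem₂ = solve-∀

  step : ∀ ys → ∑ (filter (R? x) ys) f + ∑ ys (weight xs) ≡ ∑ ys (weight (x ∷ xs))
  step []       = ≡.refl
  step (y ∷ ys) with R? x y
  ... | yes _ = ≡.trans (lem₁ (f y) (∑ (filter (R? x) ys) f) (count (λ x → R? x y) xs) (∑ ys (weight xs)))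
                        (≡.cong (f y + weight xs y +_) (step ys))
  ... | no _  = ≡.trans (lem₂ (∑ (filter (R? x) ys) f) (weight xs y) (∑ ys (weight xs)))
                        (≡.cong (weight xs y +_) (step ys))

∑-count : {R : A → B → Set r} (R? : ∀ x → Decidable (R x)) (xs : List A) (ys : List B) →
          ∑ xs (λ x → count (R? x) ys) ≡ ∑ ys (λ y → count (λ x → R? x y) xs)
∑-count R? xs ys = begin
  ∑ xs (λ x → count (R? x) ys)                  ≡⟨ ∑-cong xs (λ x → ≡.sym (∑-one (filter (R? x) ys))) ⟩
  ∑ xs (λ x → ∑ (filter (R? x) ys) (λ _ → 1))   ≡⟨ ∑-filter R? (λ _ → 1) xs ys ⟩
  ∑ ys (λ y → count (λ x → R? x y) xs * 1)      ≡⟨ ∑-cong ys (λ y → ℕ.*-identityʳ _) ⟩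
  ∑ ys (λ y → count (λ x → R? x y) xs)          ∎
  where
  open ≡.≡-Reasoning
  ∑-cong : ∀ {c} {C : Set c} (zs : List C) {f g : C → ℕ} → (∀ z → f z ≡ g z) → ∑ zs f ≡ ∑ zs g
  ∑-cong []       eq = ≡.refl
  ∑-cong (z ∷ zs) eq = ≡.cong₂ _+_ (eq z) (∑-cong zs eq)
  ∑-one : ∀ {c} {C : Set c} (zs : List C) → ∑ zs (λ _ → 1) ≡ length zs
  ∑-one zs = ≡.trans (∑-const zs 1) (ℕ.*-identityʳ _)

-- Markov's inequality: each x outside P contributes at most h, the others at most k * s.
∑-popular : {P : Pred A p} (P? : Decidable P) (f : A → ℕ) (k h s : ℕ) (xs : List A) →
            All (λ x → f x ≤ s) xs → All (λ x → ¬ P x → k * f x ≤ h) xs →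
            k * ∑ xs f ≤ length xs * h + count P? xs * (k * s)
∑-popular P? f k h s []       []       []       = ℕ.≤-reflexive (ℕ.*-zeroʳ k)
∑-popular P? f k h s (x ∷ xs) (p ∷ ps) (q ∷ qs) with P? x | ∑-popular P? f k h s xs ps qs
... | yes _ | ih = begin
  k * (f x + ∑ xs f)                                  ≡⟨ ℕ.*-distribˡ-+ k (f x) _ ⟩
  k * f x + k * ∑ xs f                                ≤⟨ ℕ.+-mono-≤ (ℕ.*-monoʳ-≤ k p) ih ⟩
  k * s + (length xs * h + count P? xs * (k * s))     ≤⟨ ℕ.m≤n+m _ h ⟩
  h + (k * s + (length xs * h + count P? xs * (k * s))) ≡⟨ lem h (k * s) (length xs * h) _ ⟩
  h + length xs * h + (k * s + count P? xs * (k * s)) ∎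
  where
  open ℕ.≤-Reasoning
  lem : ∀ i j k l → i + (j + (k + l)) ≡ i + k + (j + l)
  lem = solve-∀
... | no ¬p | ih = begin
  k * (f x + ∑ xs f)                                  ≡⟨ ℕ.*-distribˡ-+ k (f x) _ ⟩
  k * f x + k * ∑ xs f                                ≤⟨ ℕ.+-mono-≤ (q ¬p) ih ⟩
  h + (length xs * h + count P? xs * (k * s))         ≡⟨ ℕ.+-assoc h _ _ ⟨
  h + length xs * h + count P? xs * (k * s)           ∎
  where open ℕ.≤-Reasoning

∑-exists-≥-average : ∀ {x : A} {xs} (f : A → ℕ) → ∃[ y ] (Any (y ≡_) (x ∷ xs) × ∑ (x ∷ xs) f ≤ suc (length xs) * f y)
∑-exists-≥-average {x = x} {[]} f = x , here ≡.refl , ℕ.≤-refl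
∑-exists-≥-average {x = x} {x′ ∷ xs} f with ∑-exists-≥-average {x = x′} {xs} f
... | y , y∈ , avg with ℕ.≤-total (f x) (f y)
...   | inj₁ fx≤fy = y , there y∈ , ℕ.+-mono-≤ fx≤fy avg
...   | inj₂ fy≤fx = x , here ≡.refl , ℕ.+-monoʳ-≤ (f x) (ℕ.≤-trans avg (ℕ.*-monoʳ-≤ (suc (length xs)) fy≤fx))

length-─ : ∀ {P : Pred A p} {xs} (i : Any P xs) → length xs ≡ suc (length (xs ─ i))
length-─ (here _)  = ≡.refl
length-─ (there i) = ≡.cong suc (length-─ i)

Any-─ : ∀ {P : Pred A p} {Q : Pred A q} {xs} (i : Any P xs) →
        (∀ {x} → P x → Q x → ⊥) → Any Q xs → Any Q (xs ─ i)
Any-─ (here px) dis (here qx) = ⊥-elim (dis px qx)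
Any-─ (here px) dis (there j) = j
Any-─ (there i) dis (here qx) = here qx
Any-─ (there i) dis (there j) = there (Any-─ i dis j)

Any-filter⁺ : ∀ {P : Pred A p} {Q : Pred A q} (Q? : Decidable Q) {xs} →
              Any (P ∩ Q) xs → Any P (filter Q? xs)
Any-filter⁺ Q? {x ∷ xs} (here (px , qx)) with Q? x
... | yes _ = here px
... | no ¬q = contradiction qx ¬q
Any-filter⁺ Q? {x ∷ xs} (there i) with Q? x
... | yes _ = there (Any-filter⁺ Q? i)
... | no _  = Any-filter⁺ Q? i

All-filter : ∀ {P : Pred A p} {Q : Pred A q} (Q? : Decidable Q) {xs} → All P xs → All (P ∩ Q) (filter Q? xs)
All-filter Q? []       = []
All-filter Q? {x ∷ xs} (p ∷ ps) with Q? x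
... | yes q = (p , q) ∷ All-filter Q? ps
... | no _  = All-filter Q? ps

count-disjoint : ∀ {P : Pred A p} {Q : Pred A q} {T : Pred A r} (P? : Decidable P) (Q? : Decidable Q) (T? : Decidable T) →
                 (∀ {x} → P x → T x) → (∀ {x} → Q x → T x) → (∀ {x} → P x → Q x → ⊥) →
                 ∀ xs → count P? xs + count Q? xs ≤ count T? xs
count-disjoint P? Q? T? P⊆T Q⊆T P∩Q []       = z≤n
count-disjoint P? Q? T? P⊆T Q⊆T P∩Q (x ∷ xs) with P? x | Q? x | T? x | count-disjoint P? Q? T? P⊆T Q⊆T P∩Q xs
... | yes px | yes qx | _      | _  = ⊥-elim (P∩Q px qx)
... | yes px | no _   | yes _  | ih = s≤s ih
... | yes px | no _   | no ¬tx | _  = contradiction (P⊆T px) ¬tx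
... | no _   | yes qx | yes _  | ih = ℕ.≤-trans (ℕ.≤-reflexive (ℕ.+-suc _ _)) (s≤s ih)
... | no _   | yes qx | no ¬tx | _  = contradiction (Q⊆T qx) ¬tx
... | no _   | no _   | yes _  | ih = ℕ.m≤n⇒m≤1+n ih
... | no _   | no _   | no _   | ih = ih

count-∁ : ∀ {P : Pred A p} {Q : Pred A q} (P? : Decidable P) (Q? : Decidable Q) →
          (∀ {x} → ¬ P x → Q x) → ∀ xs → length xs ≤ count P? xs + count Q? xs
count-∁ P? Q? ∁P⊆Q []       = z≤n
count-∁ P? Q? ∁P⊆Q (x ∷ xs) with P? x | Q? x | count-∁ P? Q? ∁P⊆Q xs
... | yes _ | yes _ | ih = s≤s (ℕ.≤-trans ih (ℕ.+-monoʳ-≤ (count P? xs) (ℕ.n≤1+n _)))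
... | yes _ | no _  | ih = s≤s ih
... | no _  | yes _ | ih = ℕ.≤-trans (s≤s ih) (ℕ.≤-reflexive (≡.sym (ℕ.+-suc _ _)))
... | no ¬p | no ¬q | _  = contradiction (∁P⊆Q ¬p) ¬q

-- Pigeonhole principle and double counting up to setoid equality.

module Pigeonhole {a ℓ} (S : Setoid a ℓ) where
  open Setoid S
  open SetoidUnique S using (Unique)

  -- The partner of each `x` is deleted from `ys` before recursing; as a `y` determines its `x`, no
  -- partner of a later element is lost. `ys` may contain repetitions.
  pigeonhole : {R : Carrier → B → Set r} → (∀ {x x′ y} → R x y → R x′ y → x ≈ x′) →
               ∀ {xs ys} → Unique xs → All (λ x → Any (R x) ys) xs → length xs ≤ length ys
  pigeonhole R-inj []           []       = z≤n
  pigeonhole {R = R} R-inj {x ∷ xs} {ys} (x∉ ∷ xs!) (p ∷ ps) = begin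
    suc (length xs)       ≤⟨ s≤s (pigeonhole R-inj xs! (All.zipWith avoid (x∉ , ps))) ⟩
    suc (length (ys ─ p)) ≡⟨ length-─ p ⟨
    length ys             ∎
    where
    open ℕ.≤-Reasoning
    avoid : ∀ {x′} → (x ≉ x′) × Any (R x′) ys → Any (R x′) (ys ─ p)
    avoid (x≉x′ , q) = Any-─ p (λ Rxy Rx′y → x≉x′ (R-inj Rxy Rx′y)) q

  pigeonhole-count : {R : Carrier → B → Set r} {Q : Pred B q} (Q? : Decidable Q) →
                     (∀ {x x′ y} → R x y → R x′ y → x ≈ x′) →
                     ∀ {xs ys} → Unique xs → All (λ x → Any (R x ∩ Q) ys) xs → length xs ≤ count Q? ys
  pigeonhole-count Q? R-inj xs! ps = pigeonhole R-inj xs! (All.map (Any-filter⁺ Q?) ps)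

  count-≤-1 : {P : Pred Carrier p} (P? : Decidable P) → (∀ {x x′} → P x → P x′ → x ≈ x′) →
              ∀ {xs} → Unique xs → count P? xs ≤ 1
  count-≤-1 P? P-inj {[]}     []         = z≤n
  count-≤-1 P? P-inj {x ∷ xs} (x∉ ∷ xs!) with P? x
  ... | no _  = count-≤-1 P? P-inj xs!
  ... | yes px = s≤s (ℕ.≤-reflexive (none x∉))
    where
    none : ∀ {zs} → All (x ≉_) zs → count P? zs ≡ 0
    none []       = ≡.refl
    none {z ∷ zs} (x≉z ∷ x∉) with P? z
    ... | yes pz = contradiction (P-inj px pz) x≉z
    ... | no _   = none x∉

  -- Double counting of the pairs in `R`: each `y` is paired with at most one entry of `xs`.
  fibres : {R : Carrier → B → Set r} (R? : ∀ x → Decidable (R x)) →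
           (∀ {x x′ y} → R x y → R x′ y → x ≈ x′) →
           ∀ {xs} ys {k} → Unique xs → All (λ x → k ≤ count (R? x) ys) xs → length xs * k ≤ length ys
  fibres R? R-inj {xs} ys {k} xs! ks = begin
    length xs * k                                ≡⟨ ∑-const xs k ⟨
    ∑ xs (λ _ → k)                               ≤⟨ ∑-mono ks ⟩
    ∑ xs (λ x → count (R? x) ys)                 ≡⟨ ∑-count R? xs ys ⟩
    ∑ ys (λ y → count (λ x → R? x y) xs)         ≤⟨ ∑-≤-const (All.universal (λ y → count-≤-1 (λ x → R? x y) R-inj xs!) ys) ⟩
    length ys * 1                                ≡⟨ ℕ.*-identityʳ _ ⟩
    length ys                                    ∎
    where open ℕ.≤-Reasoning

-- Cardinalities of lists regarded as finite sets.

module Cardinality {a ℓ} (S : Setoid a ℓ) (_≟_ : B.Decidable (Setoid._≈_ S)) where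
  open Setoid S renaming (refl to ≈-refl; sym to ≈-sym; trans to ≈-trans)
  open SetoidUnique S using (Unique)
  open SetoidMembership S using (_∈_)
  open Pigeonhole S public

  DS : DecSetoid a ℓ
  DS = record { isDecEquivalence = record { isEquivalence = isEquivalence ; _≟_ = _≟_ } }
  open MembershipDec DS public using (_∈?_)

  dedup : List Carrier → List Carrier
  dedup = deduplicate _≟_

  card : List Carrier → ℕ
  card xs = length (dedup xs)

  dedup-! : ∀ xs → Unique (dedup xs)
  dedup-! = UniqueDec.deduplicate-! DS

  ∈-dedup⁺ : ∀ {x xs} → x ∈ xs → x ∈ dedup xs
  ∈-dedup⁺ = Membership.∈-deduplicate⁺ S _≟_ (λ y≈z x≈z → ≈-trans x≈z (≈-sym y≈z))

  ∈-dedup⁻ : ∀ {x} xs → x ∈ dedup xs → x ∈ xs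
  ∈-dedup⁻ xs = Membership.∈-deduplicate⁻ S _≟_ xs

  All-∈ : ∀ {p} {P : Pred Carrier p} {xs} → (∀ {x} → x ∈ xs → P x) → All P xs
  All-∈ {xs = []}     f = []
  All-∈ {xs = x ∷ xs} f = f (here ≈-refl) ∷ All-∈ (f ∘ there)

  pigeonhole-⊆ : ∀ {xs ys} → Unique xs → (∀ {x} → x ∈ xs → x ∈ ys) → length xs ≤ length ys
  pigeonhole-⊆ xs! xs⊆ys = pigeonhole (λ x≈y x′≈y → ≈-trans x≈y (≈-sym x′≈y)) xs! (All-∈ xs⊆ys)

  card-⊆ : ∀ {xs ys} → (∀ {x} → x ∈ xs → x ∈ ys) → card xs ≤ card ys
  card-⊆ {xs} sub = pigeonhole-⊆ (dedup-! xs) (∈-dedup⁺ ∘ sub ∘ ∈-dedup⁻ xs)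

  card-disjoint : ∀ {xs ys zs} → Unique ys → (∀ {x} → x ∈ xs → x ∈ zs) → (∀ {x} → x ∈ ys → x ∈ zs) →
                  (∀ {x} → x ∈ xs → x ∈ ys → ⊥) → card xs + length ys ≤ card zs
  card-disjoint {xs} {ys} {zs} ys! xs⊆zs ys⊆zs xs#ys = begin
    card xs + length ys         ≡⟨ length-++ (dedup xs) ⟨
    length (dedup xs ++ ys)     ≤⟨ pigeonhole-⊆ (Unique.++⁺ S (dedup-! xs) ys! disjoint) (λ x∈ → ∈-dedup⁺ (sub (Any.++⁻ (dedup xs) x∈))) ⟩
    card zs                     ∎
    where
    open ℕ.≤-Reasoning
    disjoint : ∀ {x} → ¬ (x ∈ dedup xs × x ∈ ys)
    disjoint (x∈xs , x∈ys) = xs#ys (∈-dedup⁻ xs x∈xs) x∈ys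
    sub : ∀ {x} → x ∈ dedup xs ⊎ x ∈ ys → x ∈ zs
    sub (inj₁ x∈) = xs⊆zs (∈-dedup⁻ xs x∈)
    sub (inj₂ x∈) = ys⊆zs x∈

  -- Split `us` by membership in `xs`. The part inside costs at most `card xs`; the rest lies in
  -- `ys` and misses `is`, so the two fit into `ys` side by side.
  card-∪-∩ : ∀ {us is xs ys} → (∀ {x} → x ∈ us → x ∈ xs ⊎ x ∈ ys) →
             (∀ {x} → x ∈ is → x ∈ xs) → (∀ {x} → x ∈ is → x ∈ ys) →
             card us + card is ≤ card xs + card ys
  card-∪-∩ {us} {is} {xs} {ys} us⊆ is⊆xs is⊆ys = begin
    card us + card is                                                             ≤⟨ ℕ.+-monoˡ-≤ (card is) (count-∁ (_∈? xs) (λ x → ¬? (x ∈? xs)) id (dedup us)) ⟩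
    count (_∈? xs) (dedup us) + length new + card is                              ≡⟨ ℕ.+-assoc (count (_∈? xs) (dedup us)) _ _ ⟩
    count (_∈? xs) (dedup us) + (length new + card is)                            ≤⟨ ℕ.+-mono-≤ old≤ (ℕ.≤-trans (ℕ.≤-reflexive (ℕ.+-comm (length new) _)) new≤) ⟩
    card xs + card ys                                                             ∎
    where
    open ℕ.≤-Reasoning
    resp : ∀ {x y} → x ≈ y → x ∈ xs → y ∈ xs
    resp = Membership.∈-resp-≈ S
    respʳ : ∀ {x y} → x ≈ y → ¬ (x ∈ xs) → ¬ (y ∈ xs)
    respʳ x≈y x∉ y∈ = x∉ (resp (≈-sym x≈y) y∈)
    new : List Carrier
    new = filter (λ x → ¬? (x ∈? xs)) (dedup us)
    old≤ : count (_∈? xs) (dedup us) ≤ card xs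
    old≤ = pigeonhole-⊆ (Unique.filter⁺ S (_∈? xs) (dedup-! us)) (λ x∈ → ∈-dedup⁺ (proj₂ (Membership.∈-filter⁻ S (_∈? xs) resp {xs = dedup us} x∈)))
    new⁻ : ∀ {x} → x ∈ new → x ∈ dedup us × ¬ (x ∈ xs)
    new⁻ = Membership.∈-filter⁻ S (λ x → ¬? (x ∈? xs)) respʳ {xs = dedup us}
    inside : ∀ {x} → x ∈ new → x ∈ ys
    inside x∈ with new⁻ x∈
    ... | x∈us , x∉xs with us⊆ (∈-dedup⁻ us x∈us)
    ...   | inj₁ x∈xs = contradiction x∈xs x∉xs
    ...   | inj₂ x∈ys = x∈ys
    new≤ : card is + length new ≤ card ys
    new≤ = card-disjoint (Unique.filter⁺ S (λ x → ¬? (x ∈? xs)) (dedup-! us)) is⊆ys inside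
             (λ x∈is x∈new → proj₂ (new⁻ x∈new) (is⊆xs x∈is))

-- Sumsets and Petridis's inequality.

module Sumset {a ℓ} (G : AbelianGroup a ℓ) (_≟_ : B.Decidable (AbelianGroup._≈_ G)) where
  open AbelianGroup G renaming (refl to ≈-refl; sym to ≈-sym; trans to ≈-trans)
  open import Algebra.Properties.Group group using (∙-cancelʳ)
  open SetoidUnique setoid using (Unique)
  open SetoidMembership setoid using (_∈_)
  open Cardinality setoid _≟_ public

  infixl 6 _⊕_
  _⊕_ : List Carrier → List Carrier → List Carrier
  _⊕_ = cartesianProductWith _∙_

  ∈-⊕⁺ : ∀ {x y z xs ys} → x ∈ xs → y ∈ ys → z ≈ x ∙ y → z ∈ xs ⊕ ys
  ∈-⊕⁺ x∈ y∈ z≈ = Membership.∈-resp-≈ setoid (≈-sym z≈) (Membership.∈-cartesianProductWith⁺ setoid setoid setoid ∙-cong x∈ y∈)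

  ∈-⊕⁻ : ∀ xs ys {z} → z ∈ xs ⊕ ys → ∃[ x ] ∃[ y ] (x ∈ xs × y ∈ ys × z ≈ x ∙ y)
  ∈-⊕⁻ = Membership.∈-cartesianProductWith⁻ setoid setoid setoid _∙_

  swapʳ : ∀ x y z → x ∙ y ∙ z ≈ x ∙ z ∙ y
  swapʳ x y z = ≈-trans (assoc x y z) (≈-trans (∙-congˡ (comm y z)) (≈-sym (assoc x z y)))

  -- Petridis's induction on B.  When b is added to B, the set W of those z ∈ Z with
  -- z ∙ b ∈ Z ⊕ B gives nothing new in Z ⊕ B, and W ⊕ D gives nothing new in
  -- Z ⊕ B ⊕ D; minimality says that the second loss is at least proportional to
  -- the first.
  module _ (D Z : List Carrier) (Z! : Unique Z)
           (minimal : ∀ W → Unique W → (∀ {x} → x ∈ W → x ∈ Z) →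
                      card (Z ⊕ D) * length W ≤ card (W ⊕ D) * length Z) where

    private module _ (b : Carrier) (B : List Carrier) where
      covered? : ∀ z → Dec (z ∙ b ∈ Z ⊕ B)
      covered? z = (z ∙ b) ∈? (Z ⊕ B)

      uncovered? : ∀ z → Dec (¬ (z ∙ b ∈ Z ⊕ B))
      uncovered? z = ¬? (covered? z)

      W : List Carrier
      W = filter covered? Z

      V : List Carrier
      V = filter uncovered? Z

      resp : ∀ {x y} → x ≈ y → x ∙ b ∈ Z ⊕ B → y ∙ b ∈ Z ⊕ B
      resp x≈y = Membership.∈-resp-≈ setoid (∙-congʳ x≈y)

      W⁻ : ∀ {z} → z ∈ W → z ∈ Z × z ∙ b ∈ Z ⊕ B
      W⁻ = Membership.∈-filter⁻ setoid covered? resp {xs = Z}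

      V⁻ : ∀ {z} → z ∈ V → z ∈ Z × ¬ (z ∙ b ∈ Z ⊕ B)
      V⁻ = Membership.∈-filter⁻ setoid uncovered? (λ x≈y x∉ y∈ → x∉ (resp (≈-sym x≈y) y∈)) {xs = Z}

      new-sums : card (Z ⊕ B) + length V ≤ card (Z ⊕ (b ∷ B))
      new-sums = begin
        card (Z ⊕ B) + length V              ≡⟨ ≡.cong (card (Z ⊕ B) +_) (length-map (_∙ b) V) ⟨
        card (Z ⊕ B) + length (map (_∙ b) V) ≤⟨ card-disjoint (Unique.map⁺ setoid setoid (∙-cancelʳ b _ _) (Unique.filter⁺ setoid uncovered? Z!)) old new disjoint ⟩
        card (Z ⊕ (b ∷ B))                   ∎
        where
        open ℕ.≤-Reasoning
        old : ∀ {x} → x ∈ Z ⊕ B → x ∈ Z ⊕ (b ∷ B)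
        old x∈ with ∈-⊕⁻ Z B x∈
        ... | z , y , z∈ , y∈ , x≈ = ∈-⊕⁺ z∈ (there y∈) x≈
        new : ∀ {x} → x ∈ map (_∙ b) V → x ∈ Z ⊕ (b ∷ B)
        new x∈ with Membership.∈-map⁻ setoid setoid x∈
        ... | z , z∈ , x≈ = ∈-⊕⁺ (proj₁ (V⁻ z∈)) (here ≈-refl) x≈
        disjoint : ∀ {x} → x ∈ Z ⊕ B → x ∈ map (_∙ b) V → ⊥
        disjoint x∈ x∈′ with Membership.∈-map⁻ setoid setoid x∈′
        ... | z , z∈ , x≈ = proj₂ (V⁻ z∈) (Membership.∈-resp-≈ setoid x≈ x∈)

      -- Inclusion and exclusion for `Z ⊕ B ⊕ D` and the translate of `Z ⊕ D` by `b`. Their union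
      -- contains `Z ⊕ (b ∷ B) ⊕ D`, and their intersection contains the translate of `W ⊕ D`,
      -- because `W` translated by `b` stays inside `Z ⊕ B`.
      new-sums⊕D : card (Z ⊕ (b ∷ B) ⊕ D) + card (W ⊕ D) ≤ card (Z ⊕ B ⊕ D) + card (Z ⊕ D)
      new-sums⊕D = begin
        card (Z ⊕ (b ∷ B) ⊕ D) + card (W ⊕ D)             ≤⟨ ℕ.+-monoʳ-≤ (card (Z ⊕ (b ∷ B) ⊕ D)) (card-shift (W ⊕ D)) ⟩
        card (Z ⊕ (b ∷ B) ⊕ D) + card (map (_∙ b) (W ⊕ D)) ≤⟨ card-∪-∩ union inter₁ inter₂ ⟩
        card (Z ⊕ B ⊕ D) + card (map (_∙ b) (Z ⊕ D))       ≤⟨ ℕ.+-monoʳ-≤ (card (Z ⊕ B ⊕ D)) (card-shift⁻ (Z ⊕ D)) ⟩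
        card (Z ⊕ B ⊕ D) + card (Z ⊕ D)                    ∎
        where
        open ℕ.≤-Reasoning
        ∈-shift : ∀ {x y xs} → y ∈ xs → x ≈ y ∙ b → x ∈ map (_∙ b) xs
        ∈-shift y∈ x≈ = Membership.∈-resp-≈ setoid (≈-sym x≈) (Membership.∈-map⁺ setoid setoid ∙-congʳ y∈)
        card-shift : ∀ xs → card xs ≤ card (map (_∙ b) xs)
        card-shift xs = pigeonhole {R = λ x y → x ∙ b ≈ y} (λ p q → ∙-cancelʳ b _ _ (≈-trans p (≈-sym q))) (dedup-! xs)
          (All-∈ (λ x∈ → ∈-dedup⁺ (∈-shift (∈-dedup⁻ xs x∈) ≈-refl)))
        card-shift⁻ : ∀ xs → card (map (_∙ b) xs) ≤ card xs
        card-shift⁻ xs = pigeonhole {R = λ x y → x ≈ y ∙ b} (λ p q → ≈-trans p (≈-sym q)) (dedup-! (map (_∙ b) xs))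
          (All-∈ (λ x∈ → unshift (∈-dedup⁻ (map (_∙ b) xs) x∈)))
          where
          unshift : ∀ {x} → x ∈ map (_∙ b) xs → Any (λ y → x ≈ y ∙ b) (dedup xs)
          unshift x∈ with Membership.∈-map⁻ setoid setoid x∈
          ... | z , z∈ , x≈ = Any.map (λ z≈y → ≈-trans x≈ (∙-congʳ z≈y)) (∈-dedup⁺ z∈)
        union : ∀ {x} → x ∈ Z ⊕ (b ∷ B) ⊕ D → x ∈ Z ⊕ B ⊕ D ⊎ x ∈ map (_∙ b) (Z ⊕ D)
        union x∈ with ∈-⊕⁻ (Z ⊕ (b ∷ B)) D x∈
        ... | y , d , y∈ , d∈ , x≈ with ∈-⊕⁻ Z (b ∷ B) y∈
        ...   | z , c , z∈ , here c≈b , y≈ = inj₂ (∈-shift (∈-⊕⁺ z∈ d∈ ≈-refl)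
                 (≈-trans x≈ (≈-trans (∙-congʳ (≈-trans y≈ (∙-congˡ c≈b))) (swapʳ z b d))))
        ...   | z , c , z∈ , there c∈ , y≈ = inj₁ (∈-⊕⁺ (∈-⊕⁺ z∈ c∈ y≈) d∈ x≈)
        inter₁ : ∀ {x} → x ∈ map (_∙ b) (W ⊕ D) → x ∈ Z ⊕ B ⊕ D
        inter₁ x∈ with Membership.∈-map⁻ setoid setoid x∈
        ... | y , y∈ , x≈ with ∈-⊕⁻ W D y∈
        ...   | z , d , z∈ , d∈ , y≈ = ∈-⊕⁺ (proj₂ (W⁻ z∈)) d∈ (≈-trans x≈ (≈-trans (∙-congʳ y≈) (swapʳ z d b)))
        inter₂ : ∀ {x} → x ∈ map (_∙ b) (W ⊕ D) → x ∈ map (_∙ b) (Z ⊕ D)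
        inter₂ x∈ with Membership.∈-map⁻ setoid setoid x∈
        ... | y , y∈ , x≈ with ∈-⊕⁻ W D y∈
        ...   | z , d , z∈ , d∈ , y≈ = ∈-shift (∈-⊕⁺ (proj₁ (W⁻ z∈)) d∈ y≈) x≈

    petridis : ∀ B → card (Z ⊕ B ⊕ D) * length Z ≤ card (Z ⊕ D) * card (Z ⊕ B)
    petridis [] = ℕ.≤-trans (ℕ.≤-reflexive (≡.cong (_* length Z) empty)) z≤n
      where
      empty : card (Z ⊕ [] ⊕ D) ≡ 0
      empty = ℕ.n≤0⇒n≡0 (card-⊆ {ys = []} (λ x∈ → absurd (∈-⊕⁻ (Z ⊕ []) D x∈)))
        where
        absurd : ∀ {x} → ∃[ y ] ∃[ d ] (y ∈ Z ⊕ [] × d ∈ D × x ≈ y ∙ d) → x ∈ []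
        absurd (y , d , y∈ , _) with ∈-⊕⁻ Z [] y∈
        ... | _ , _ , _ , () , _
    -- The loss `v′ * z` is carried on both sides in place of a subtraction; minimality enters at
    -- the end, as `v * w ≤ v′ * z`.
    petridis (b ∷ B) = ℕ.+-cancelʳ-≤ (v′ * z) (α′ * z) (v * β′) (begin
      α′ * z + v′ * z      ≡⟨ ℕ.*-distribʳ-+ z α′ v′ ⟨
      (α′ + v′) * z        ≤⟨ ℕ.*-monoˡ-≤ z (new-sums⊕D b B) ⟩
      (α + v) * z          ≡⟨ ℕ.*-distribʳ-+ z α v ⟩
      α * z + v * z        ≤⟨ ℕ.+-mono-≤ (petridis B) (ℕ.*-monoʳ-≤ v (count-∁ (covered? b B) (uncovered? b B) id Z)) ⟩
      v * β + v * (w + k)  ≡⟨ lem v β w k ⟩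
      v * (β + k) + v * w  ≤⟨ ℕ.+-mono-≤ (ℕ.*-monoʳ-≤ v (new-sums b B)) (minimal (W b B) (Unique.filter⁺ setoid (covered? b B) Z!) (proj₁ ∘ W⁻ b B)) ⟩
      v * β′ + v′ * z      ∎)
      where
      open ℕ.≤-Reasoning
      α α′ β β′ v v′ z w k : ℕ
      α  = card (Z ⊕ B ⊕ D)
      α′ = card (Z ⊕ (b ∷ B) ⊕ D)
      β  = card (Z ⊕ B)
      β′ = card (Z ⊕ (b ∷ B))
      v  = card (Z ⊕ D)
      v′ = card (W b B ⊕ D)
      z  = length Z
      w  = length (W b B)
      k  = length (V b B)
      lem : ∀ v β w k → v * β + v * (w + k) ≡ v * (β + k) + v * w
      lem = solve-∀

  -- The double negation avoids searching through all subsets for a minimiser; it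
  -- is harmless, as only a decidable inequality is deduced.
  ¬¬-petridis : ∀ D → Unique D → 0 < length D →
    ¬ ¬ (∃[ Z ] (Unique Z × 0 < length Z × length Z ≤ length D ×
                 card (Z ⊕ D) * length D ≤ card (D ⊕ D) * length Z ×
                 (∀ B → card (Z ⊕ B ⊕ D) * length Z ≤ card (Z ⊕ D) * card (Z ⊕ B))))
  ¬¬-petridis D D! 0<D none = go D D! 0<D ℕ.≤-refl ℕ.≤-refl (<-wellFounded _)
    where
    -- The descent is on `card (Z ⊕ D)` rather than on the ratio to `length Z`: a subset `W` of
    -- smaller ratio is no longer than `Z`, so its sumset with `D` is strictly smaller as well.
    go : ∀ Z → Unique Z → 0 < length Z → length Z ≤ length D →
         card (Z ⊕ D) * length D ≤ card (D ⊕ D) * length Z → Acc _<_ (card (Z ⊕ D)) → ⊥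
    go Z Z! 0<Z Z≤D ratio (acc rec) = none (Z , Z! , 0<Z , Z≤D , ratio , petridis D Z Z! minimal)
      where
      minimal : ∀ W → Unique W → (∀ {x} → x ∈ W → x ∈ Z) →
                card (Z ⊕ D) * length W ≤ card (W ⊕ D) * length Z
      minimal W W! W⊆Z with card (Z ⊕ D) * length W ℕ.≤? card (W ⊕ D) * length Z
      ... | yes le = le
      ... | no ¬le = ⊥-elim (go W W! 0<W (ℕ.≤-trans W≤Z Z≤D) ratio′ (rec smaller))
        where
        open ℕ.≤-Reasoning
        v v′ w z d s : ℕ
        v  = card (Z ⊕ D)
        v′ = card (W ⊕ D)
        w  = length W
        z  = length Z
        d  = length D
        s  = card (D ⊕ D)
        lt : v′ * z < v * w
        lt = ℕ.≰⇒> ¬le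
        W≤Z : w ≤ z
        W≤Z = pigeonhole-⊆ W! W⊆Z
        smaller : v′ < v
        smaller = ℕ.*-cancelʳ-< z v′ v (ℕ.<-≤-trans lt (ℕ.*-monoʳ-≤ v W≤Z))
        0<W : 0 < w
        0<W = ℕ.n≢0⇒n>0 (λ w≡0 → ℕ.n≮0 (ℕ.<-≤-trans lt (ℕ.≤-reflexive (≡.trans (≡.cong (v *_) w≡0) (ℕ.*-zeroʳ v)))))
        ratio′ : v′ * d ≤ s * w
        ratio′ = ℕ.*-cancelʳ-≤ (v′ * d) (s * w) z {{ℕ.>-nonZero 0<Z}} (begin
          v′ * d * z   ≡⟨ lem v′ d z ⟩
          v′ * z * d   ≤⟨ ℕ.*-monoˡ-≤ d (ℕ.<⇒≤ lt) ⟩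
          v * w * d    ≡⟨ lem v w d ⟩
          v * d * w    ≤⟨ ℕ.*-monoˡ-≤ w ratio ⟩
          s * z * w    ≡⟨ lem s z w ⟩
          s * w * z    ∎)
          where
          lem : ∀ i j k → i * j * k ≡ i * k * j
          lem = solve-∀

-- Ordered field facts and sorted lists.

module OrderedField {c ℓ₁ ℓ₂} (ℝ : Reals c ℓ₁ ℓ₂) where
  open Reals ℝ public
    renaming (_+_ to _+ᴿ_; _*_ to _*ᴿ_; _-_ to _-ᴿ_; _<_ to _<ᴿ_;
              refl to ≈-refl; sym to ≈-sym; trans to ≈-trans; +-monoˡ-< to +ᴿ-monoˡ-<)
    using (Carrier; setoid; commutativeSemiring; +-abelianGroup; -_; 0#; 1#; _≈_; _≉_;
           _≟_; _<?_; compare; +-cong; +-congˡ; +-congʳ; *-cong; *-congˡ; *-congʳ; +-comm; +-assoc; *-comm; *-assoc;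
           +-identityˡ; +-identityʳ; *-identityˡ; *-identityʳ; zeroˡ; zeroʳ; distribˡ; distribʳ;
           -‿inverseˡ; -‿inverseʳ; -‿cong; isStrictTotalOrder; *-pos; 0≉1)
  open IsStrictTotalOrder isStrictTotalOrder public
    using (irrefl; asym; <-respˡ-≈; <-respʳ-≈) renaming (trans to <ᴿ-trans)
  open SemiringSolver commutativeSemiring public
    using (solve; _:+_; _:*_; _:=_)
  open SetoidUnique setoid public using (Unique)
  open SetoidMembership setoid public using (_∈_; find)

  sq : Carrier → Carrier
  sq x = x *ᴿ x

  sub-add : ∀ x y → (x -ᴿ y) +ᴿ y ≈ x
  sub-add x y = ≈-trans (+-assoc x (- y) y) (≈-trans (+-congˡ (-‿inverseˡ y)) (+-identityʳ x))

  telescope : ∀ x y z → (x -ᴿ y) +ᴿ (y -ᴿ z) ≈ x -ᴿ z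
  telescope x y z = ≈-trans (≈-sym (+-assoc (x -ᴿ y) y (- z))) (+-congʳ (sub-add x y))

  ≈-sub : ∀ {x y z} → x ≈ z +ᴿ y → x -ᴿ y ≈ z
  ≈-sub {x} {y} {z} x≈ = ≈-trans (+-congʳ x≈) (≈-trans (+-assoc z y (- y)) (≈-trans (+-congˡ (-‿inverseʳ y)) (+-identityʳ z)))

  +-cancelʳ : ∀ {x y} z → x +ᴿ z ≈ y +ᴿ z → x ≈ y
  +-cancelʳ {x} {y} z eq = ≈-trans (≈-sym (≈-sub ≈-refl)) (≈-sub eq)

  +-monoʳ-<ᴿ : ∀ z {x y} → x <ᴿ y → z +ᴿ x <ᴿ z +ᴿ y
  +-monoʳ-<ᴿ z x<y = <-respˡ-≈ (+-comm _ z) (<-respʳ-≈ (+-comm _ z) (+ᴿ-monoˡ-< z x<y))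

  <⇒0<sub : ∀ {x y} → x <ᴿ y → 0# <ᴿ y -ᴿ x
  <⇒0<sub {x} {y} x<y = <-respˡ-≈ (-‿inverseʳ x) (+ᴿ-monoˡ-< (- x) x<y)

  *-monoʳ-<ᴿ : ∀ {x y z} → 0# <ᴿ z → x <ᴿ y → x *ᴿ z <ᴿ y *ᴿ z
  *-monoʳ-<ᴿ {x} {y} {z} 0<z x<y =
    <-respˡ-≈ (+-identityˡ (x *ᴿ z))
      (<-respʳ-≈ (≈-trans (≈-sym (distribʳ z (y -ᴿ x) x)) (*-congʳ (sub-add y x)))
        (+ᴿ-monoˡ-< (x *ᴿ z) (*-pos (<⇒0<sub x<y) 0<z)))

  *-cancelˡ-pos : ∀ {x y z} → 0# <ᴿ z → z *ᴿ x ≈ z *ᴿ y → x ≈ y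
  *-cancelˡ-pos {x} {y} {z} 0<z zx≈zy with compare x y
  ... | tri< x<y _ _ = ⊥-elim (irrefl (≈-trans (*-comm x z) (≈-trans zx≈zy (*-comm z y))) (*-monoʳ-<ᴿ 0<z x<y))
  ... | tri≈ _ x≈y _ = x≈y
  ... | tri> _ _ y<x = ⊥-elim (irrefl (≈-trans (*-comm y z) (≈-trans (≈-sym zx≈zy) (*-comm z x))) (*-monoʳ-<ᴿ 0<z y<x))

  +-pos : ∀ {x y} → 0# <ᴿ x → 0# <ᴿ y → 0# <ᴿ x +ᴿ y
  +-pos {x} {y} 0<x 0<y = <ᴿ-trans 0<y (<-respˡ-≈ (+-identityˡ y) (+ᴿ-monoˡ-< y 0<x))

  neg⇒0<- : ∀ {x} → x <ᴿ 0# → 0# <ᴿ - x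
  neg⇒0<- {x} x<0 = <-respʳ-≈ (+-identityˡ (- x)) (<⇒0<sub x<0)

  neg-sq : ∀ x → - x *ᴿ - x ≈ x *ᴿ x
  neg-sq x = +-cancelʳ (- x *ᴿ x) (≈-trans (≈-sym (distribˡ (- x) (- x) x))
    (≈-trans (*-congˡ (-‿inverseˡ x)) (≈-trans (zeroʳ (- x)) (≈-sym
      (≈-trans (≈-sym (distribʳ x x (- x))) (≈-trans (*-congʳ (-‿inverseʳ x)) (zeroˡ x)))))))

  sq-pos : ∀ {x} → x ≉ 0# → 0# <ᴿ sq x
  sq-pos {x} x≉0 with compare x 0#
  ... | tri< x<0 _ _ = <-respʳ-≈ (neg-sq x) (*-pos (neg⇒0<- x<0) (neg⇒0<- x<0))
  ... | tri≈ _ x≈0 _ = contradiction x≈0 x≉0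
  ... | tri> _ _ 0<x = *-pos 0<x 0<x

  0<1 : 0# <ᴿ 1#
  0<1 = <-respʳ-≈ (*-identityˡ 1#) (sq-pos (0≉1 ∘ ≈-sym))

  0<2 : 0# <ᴿ 1# +ᴿ 1#
  0<2 = +-pos 0<1 0<1

  sq-injective-pos : ∀ {x y} → 0# <ᴿ x → 0# <ᴿ y → sq x ≈ sq y → x ≈ y
  sq-injective-pos {x} {y} 0<x 0<y eq = *-cancelˡ-pos (+-pos 0<x 0<y) (≈-trans (distribʳ x x y)
    (≈-trans (+-cong eq (*-comm y x)) (≈-trans (+-comm (y *ᴿ y) (x *ᴿ y)) (≈-sym (distribʳ y x y)))))

  sq-zero : ∀ {x} → sq x ≈ 0# → x ≈ 0#
  sq-zero {x} eq with x ≟ 0#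
  ... | yes x≈0 = x≈0
  ... | no x≉0  = ⊥-elim (irrefl (≈-sym eq) (sq-pos x≉0))

  neg-injective : ∀ {x y} → - x ≈ - y → x ≈ y
  neg-injective {x} {y} eq = +-cancelʳ (- x) (≈-trans (-‿inverseʳ x) (≈-trans (≈-sym (-‿inverseʳ y)) (+-congˡ (≈-sym eq))))

  -- Only positivity has to agree: equal squares already separate zero from negative numbers. So the
  -- square together with one bit determines a real.
  sq-injective : ∀ {x y} → (0# <ᴿ x → 0# <ᴿ y) → (0# <ᴿ y → 0# <ᴿ x) → sq x ≈ sq y → x ≈ y
  sq-injective {x} {y} x⇒y y⇒x eq with compare x 0# | compare y 0#
  ... | tri≈ _ x≈0 _ | _            = ≈-trans x≈0 (≈-sym (sq-zero (≈-trans (≈-sym eq) (≈-trans (*-congʳ x≈0) (zeroˡ x)))))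
  ... | tri< _ _ _   | tri≈ _ y≈0 _ = ≈-trans (sq-zero (≈-trans eq (≈-trans (*-congʳ y≈0) (zeroˡ y)))) (≈-sym y≈0)
  ... | tri> _ _ 0<x | _            = sq-injective-pos 0<x (x⇒y 0<x) eq
  ... | tri< x<0 _ _ | tri< y<0 _ _ = neg-injective (sq-injective-pos (neg⇒0<- x<0) (neg⇒0<- y<0) (≈-trans (neg-sq x) (≈-trans eq (≈-sym (neg-sq y)))))
  ... | tri< x<0 _ _ | tri> _ _ 0<y = ⊥-elim (asym x<0 (y⇒x 0<y))

  SameElements : List Carrier → List Carrier → Set _
  SameElements xs ys = (∀ {x} → x ∈ xs → x ∈ ys) × (∀ {x} → x ∈ ys → x ∈ xs)

  insert : Carrier → List Carrier → List Carrier
  insert x []       = x ∷ []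
  insert x (y ∷ ys) with compare x y
  ... | tri< _ _ _ = x ∷ y ∷ ys
  ... | tri≈ _ _ _ = y ∷ ys
  ... | tri> _ _ _ = y ∷ insert x ys

  All-insert : ∀ {p} {P : Pred Carrier p} {x} → P x → ∀ {ys} → All P ys → All P (insert x ys)
  All-insert px []       = px ∷ []
  All-insert {x = x} px {y ∷ ys} (py ∷ pys) with compare x y
  ... | tri< _ _ _ = px ∷ py ∷ pys
  ... | tri≈ _ _ _ = py ∷ pys
  ... | tri> _ _ _ = py ∷ All-insert px pys

  insert-sorted : ∀ x {ys} → AllPairs _<ᴿ_ ys → AllPairs _<ᴿ_ (insert x ys)
  insert-sorted x []       = [] ∷ []
  insert-sorted x {y ∷ ys} (y< ∷ ys<) with compare x y
  ... | tri< x<y _ _ = (x<y ∷ All.map (<ᴿ-trans x<y) y<) ∷ y< ∷ ys<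
  ... | tri≈ _ _ _   = y< ∷ ys<
  ... | tri> _ _ y<x = All-insert y<x y< ∷ insert-sorted x ys<

  ∈-insert⁺ : ∀ {z} x ys → z ∈ x ∷ ys → z ∈ insert x ys
  ∈-insert⁺ x []       z∈ = z∈
  ∈-insert⁺ x (y ∷ ys) z∈ with compare x y
  ... | tri< _ _ _ = z∈
  ∈-insert⁺ x (y ∷ ys) (here z≈x)         | tri≈ _ x≈y _ = here (≈-trans z≈x x≈y)
  ∈-insert⁺ x (y ∷ ys) (there z∈)         | tri≈ _ x≈y _ = z∈
  ∈-insert⁺ x (y ∷ ys) (here z≈x)         | tri> _ _ _ = there (∈-insert⁺ x ys (here z≈x))
  ∈-insert⁺ x (y ∷ ys) (there (here z≈y)) | tri> _ _ _ = here z≈y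
  ∈-insert⁺ x (y ∷ ys) (there (there z∈)) | tri> _ _ _ = there (∈-insert⁺ x ys (there z∈))

  -- Solymosi's argument runs through consecutive slopes, so the set is needed as a strictly
  -- increasing list.
  sorted-set : ∀ xs → ∃[ ys ] (AllPairs _<ᴿ_ ys × SameElements xs ys)
  sorted-set []       = [] , [] , id , id
  sorted-set (x ∷ xs) with sorted-set xs
  ... | ys , ys< , xs⊆ys , ys⊆xs = insert x ys , insert-sorted x ys< , to , All.lookupₛ setoid (λ x≈y x∈ → Membership.∈-resp-≈ setoid x≈y x∈) back
    where
    to : ∀ {z} → z ∈ x ∷ xs → z ∈ insert x ys
    to (here z≈x) = ∈-insert⁺ x ys (here z≈x)
    to (there z∈) = ∈-insert⁺ x ys (there (xs⊆ys z∈))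
    back : All (_∈ x ∷ xs) (insert x ys)
    back = All-insert (here ≈-refl) (All.map there (All.tabulateₛ setoid ys⊆xs))

-- Cartesian products and the Cauchy-Schwarz inequality.

All-cartesianProduct : ∀ {a b p q} {A : Set a} {B : Set b} {P : Pred A p} {Q : Pred B q} {xs ys} →
                       All P xs → All Q ys → All (λ (x , y) → P x × Q y) (cartesianProduct xs ys)
All-cartesianProduct []         qs = []
All-cartesianProduct (px ∷ pxs) qs = All.++⁺ (All.map⁺ (All.map (px ,_) qs)) (All-cartesianProduct pxs qs)

length-cartesianProduct : ∀ {a b} {A : Set a} {B : Set b} (xs : List A) (ys : List B) →
                          length (cartesianProduct xs ys) ≡ length xs * length ys
length-cartesianProduct []       ys = ≡.refl
length-cartesianProduct (x ∷ xs) ys = ≡.trans (length-++ (map (x ,_) ys))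
  (≡.cong₂ _+_ (length-map (x ,_) ys) (length-cartesianProduct xs ys))

2mn≤m²+n² : ∀ m n → 2 * (m * n) ≤ m * m + n * n
2mn≤m²+n² m n with ℕ.≤-total m n
... | inj₁ m≤n with ℕ.m≤n⇒∃[o]m+o≡n m≤n
...   | k , ≡.refl = ℕ.≤-trans (ℕ.m≤m+n _ (k * k)) (ℕ.≤-reflexive (lem m k))
  where
  lem : ∀ m k → 2 * (m * (m + k)) + k * k ≡ m * m + (m + k) * (m + k)
  lem = solve-∀
2mn≤m²+n² m n | inj₂ n≤m with ℕ.m≤n⇒∃[o]m+o≡n n≤m
...   | k , ≡.refl = ℕ.≤-trans (ℕ.m≤m+n _ (k * k)) (ℕ.≤-reflexive (lem n k))
  where
  lem : ∀ n k → 2 * ((n + k) * n) + k * k ≡ (n + k) * (n + k) + n * n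
  lem = solve-∀

cauchy-schwarz : ∀ {a} {A : Set a} (f : A → ℕ) xs → ∑ xs f * ∑ xs f ≤ length xs * ∑ xs (λ x → f x * f x)
cauchy-schwarz f []       = z≤n
cauchy-schwarz f (x ∷ xs) = begin
  (y + s) * (y + s)                 ≡⟨ lem₁ y s ⟩
  y * y + 2 * (y * s) + s * s       ≤⟨ ℕ.+-mono-≤ (ℕ.+-monoʳ-≤ (y * y) (cross n (cauchy-schwarz f xs))) (cauchy-schwarz f xs) ⟩
  y * y + (n * (y * y) + t) + n * t ≡⟨ lem₂ y n t ⟩
  (1 + n) * (y * y + t)             ∎
  where
  open ℕ.≤-Reasoning
  y s t n : ℕ
  y = f x
  s = ∑ xs f
  t = ∑ xs (λ x → f x * f x)
  n = length xs
  lem₁ : ∀ y s → (y + s) * (y + s) ≡ y * y + 2 * (y * s) + s * s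
  lem₁ = solve-∀
  lem₂ : ∀ y n t → y * y + (n * (y * y) + t) + n * t ≡ (1 + n) * (y * y + t)
  lem₂ = solve-∀
  -- This is 2 (n y) s ≤ (n y)² + s² divided by `n`. For `n` zero no division is possible, but then
  -- the hypothesis forces `s` to vanish.
  cross : ∀ n → s * s ≤ n * t → 2 * (y * s) ≤ n * (y * y) + t
  cross zero ss≤ with ℕ.m*n≡0⇒m≡0∨n≡0 s (ℕ.n≤0⇒n≡0 ss≤)
  ... | inj₁ s≡0 = ℕ.≤-trans (ℕ.≤-reflexive (≡.trans (≡.cong (λ s → 2 * (y * s)) s≡0) (≡.cong (2 *_) (ℕ.*-zeroʳ y)))) z≤n
  ... | inj₂ s≡0 = ℕ.≤-trans (ℕ.≤-reflexive (≡.trans (≡.cong (λ s → 2 * (y * s)) s≡0) (≡.cong (2 *_) (ℕ.*-zeroʳ y)))) z≤n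
  cross n@(suc _) ss≤ = ℕ.*-cancelˡ-≤ n (begin
    n * (2 * (y * s))            ≡⟨ lem₃ n y s ⟩
    2 * ((n * y) * s)            ≤⟨ 2mn≤m²+n² (n * y) s ⟩
    n * y * (n * y) + s * s      ≤⟨ ℕ.+-monoʳ-≤ (n * y * (n * y)) ss≤ ⟩
    n * y * (n * y) + n * t      ≡⟨ lem₄ n y t ⟩
    n * (n * (y * y) + t)        ∎)
    where
    lem₃ : ∀ n y s → n * (2 * (y * s)) ≡ 2 * ((n * y) * s)
    lem₃ = solve-∀
    lem₄ : ∀ n y t → n * y * (n * y) + n * t ≡ n * (n * (y * y) + t)
    lem₄ = solve-∀

-- Solymosi's sum-product inequality for a set of positive reals.

module SumProduct {c ℓ₁ ℓ₂} (ℝ : Reals c ℓ₁ ℓ₂) where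
  open OrderedField ℝ
  open Sumset +-abelianGroup _≟_

  infixl 7 _⊗_
  _⊗_ : List Carrier → List Carrier → List Carrier
  _⊗_ = cartesianProductWith _*ᴿ_

  ∈-⊗⁺ : ∀ {x y z xs ys} → x ∈ xs → y ∈ ys → z ≈ x *ᴿ y → z ∈ xs ⊗ ys
  ∈-⊗⁺ x∈ y∈ z≈ = Membership.∈-resp-≈ setoid (≈-sym z≈) (Membership.∈-cartesianProductWith⁺ setoid setoid setoid *-cong x∈ y∈)

  module Rows (D : List Carrier) (sorted : AllPairs _<ᴿ_ D) (positive : All (0# <ᴿ_) D) where

    private
      m π σ : ℕ
      m = length D
      π = card (D ⊗ D)
      σ = card (D ⊕ D)

    D! : Unique D
    D! = AllPairs.map (λ x<y x≈y → irrefl x≈y x<y) sorted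

    pos : ∀ {x} → x ∈ D → 0# <ᴿ x
    pos = All.lookupₛ setoid <-respʳ-≈ positive

    -- The dilate `a D`, i.e. row `a` of the multiplication table of `D`; testing membership in it
    -- takes the place of division by `a`.
    InRow : Carrier → Carrier → Set _
    InRow a p = Any (λ b → p ≈ a *ᴿ b) D

    inRow? : ∀ a → Decidable (InRow a)
    inRow? a p = Any.any? (λ b → p ≟ (a *ᴿ b)) D

    products : List Carrier
    products = dedup (D ⊗ D)

    row : Carrier → List Carrier
    row a = filter (inRow? a) products

    row! : ∀ a → Unique (row a)
    row! a = Unique.filter⁺ setoid (inRow? a) (dedup-! (D ⊗ D))

    -- ∣ aD ∩ a₀D ∣
    common : Carrier → Carrier → ℕ
    common a₀ a = count (inRow? a) (row a₀)

    common≤m : ∀ a₀ a → common a₀ a ≤ m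
    common≤m a₀ a = pigeonhole {R = λ p b → p ≈ a *ᴿ b} (λ p≈ p′≈ → ≈-trans p≈ (≈-sym p′≈))
      (Unique.filter⁺ setoid (inRow? a) (row! a₀)) (All.all-filter (inRow? a) (row a₀))

    m≤row : ∀ {a} → a ∈ D → m ≤ length (row a)
    m≤row {a} a∈ = pigeonhole-count {R = λ b p → p ≈ a *ᴿ b} (inRow? a)
      (λ p≈ p≈′ → *-cancelˡ-pos (pos a∈) (≈-trans (≈-sym p≈) p≈′)) D! (All-∈ locate)
      where
      locate : ∀ {b} → b ∈ D → Any (λ p → p ≈ a *ᴿ b × InRow a p) products
      locate {b} b∈ = Any.map (λ ab≈p → ≈-sym ab≈p , Any.map (λ b≈b′ → ≈-trans (≈-sym ab≈p) (*-congˡ b≈b′)) b∈)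
        (∈-dedup⁺ (∈-⊗⁺ a∈ b∈ ≈-refl))

    -- Cauchy–Schwarz bounds the number of solutions of a b = a₀ c from below,
    -- and a₀ is then fixed by averaging.
    energy : m ≡ 0 ⊎ (∃[ a₀ ] (a₀ ∈ D × m * m * m ≤ π * ∑ D (common a₀)))
    energy = go D ≡.refl
      where
      s : Carrier → ℕ
      s p = count (λ a → inRow? a p) D
      F : Carrier → ℕ
      F a₀ = ∑ D (common a₀)

      total : m * m ≤ ∑ products s
      total = begin
        m * m                        ≡⟨ ∑-const D m ⟨
        ∑ D (λ _ → m)                ≤⟨ ∑-mono (All-∈ m≤row) ⟩
        ∑ D (length ∘ row)           ≡⟨ ∑-count inRow? D products ⟩
        ∑ products s                 ∎
        where open ℕ.≤-Reasoning

      -- Both sides count the triples `(a₀ , a , p)` with `p` in `a₀ D` and in `a D`, which is the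
      -- multiplicative energy of `D`.
      squares : ∑ products (λ p → s p * s p) ≡ ∑ D F
      squares = ≡.trans (≡.sym (∑-filter inRow? s D products)) (cong-∑ D)
        where
        cong-∑ : ∀ zs → ∑ zs (λ a → ∑ (row a) s) ≡ ∑ zs F
        cong-∑ []       = ≡.refl
        cong-∑ (z ∷ zs) = ≡.cong₂ _+_ (≡.sym (∑-count inRow? D (row z))) (cong-∑ zs)

      go : ∀ D′ → D ≡ D′ → m ≡ 0 ⊎ (∃[ a₀ ] (a₀ ∈ D × m * m * m ≤ π * F a₀))
      go []       D≡[] = inj₁ (≡.cong length D≡[])
      go (x ∷ xs) D≡∷ with ∑-exists-≥-average {x = x} {xs} F
      ... | a₀ , a₀∈ , avg = inj₂ (a₀ , ≡.subst (a₀ ∈_) (≡.sym D≡∷) (Any.map (λ { ≡.refl → ≈-refl }) a₀∈) ,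
            ℕ.*-cancelˡ-≤ (suc (length xs)) (begin
              suc (length xs) * (m * m * m)         ≡⟨ ≡.cong (λ k → k * (m * m * m)) m≡ ⟨
              m * (m * m * m)                       ≡⟨ lem m ⟩
              m * m * (m * m)                       ≤⟨ ℕ.*-mono-≤ total total ⟩
              ∑ products s * ∑ products s           ≤⟨ cauchy-schwarz s products ⟩
              π * ∑ products (λ p → s p * s p)      ≡⟨ ≡.cong (π *_) squares ⟩
              π * ∑ D F                             ≡⟨ ≡.cong (λ zs → π * ∑ zs F) D≡∷ ⟩
              π * ∑ (x ∷ xs) F                      ≤⟨ ℕ.*-monoʳ-≤ π avg ⟩
              π * (suc (length xs) * F a₀)          ≡⟨ lem′ π (suc (length xs)) (F a₀) ⟩
              suc (length xs) * (π * F a₀)          ∎))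
        where
        open ℕ.≤-Reasoning
        m≡ : m ≡ suc (length xs)
        m≡ = ≡.cong length D≡∷
        lem : ∀ m → m * (m * m * m) ≡ m * m * (m * m)
        lem = solve-∀
        lem′ : ∀ i j k → i * (j * k) ≡ j * (i * k)
        lem′ = solve-∀

    module Slopes {a₀ : Carrier} (a₀∈ : a₀ ∈ D) where

      points : List (Carrier × Carrier)
      points = cartesianProduct (dedup (D ⊕ D)) (dedup (D ⊕ D))

      line : Carrier → List Carrier
      line a = filter (inRow? a) (row a₀)

      -- In the right half-plane, v / u > a / a₀ with the denominators cleared: the point lies above
      -- the line of slope a / a₀.
      Above : Carrier → Carrier × Carrier → Set _
      Above a (u , v) = 0# <ᴿ u × a *ᴿ u <ᴿ a₀ *ᴿ v

      above? : ∀ a → Decidable (Above a)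
      above? a (u , v) = (0# <? u) ×-dec ((a *ᴿ u) <? (a₀ *ᴿ v))

      -- Sums of points lie strictly between the two lines, but the sector is closed at its upper
      -- line, so that it is exactly the difference of two `Above` regions and consecutive sectors
      -- are disjoint.
      Between : Carrier → Carrier → Carrier × Carrier → Set _
      Between a a′ q = Above a q × ¬ Above a′ q

      between? : ∀ a a′ → Decidable (Between a a′)
      between? a a′ q = above? a q ×-dec ¬? (above? a′ q)

      -- The entries p = a b = a₀ c of line a stand for the points (b , c) of
      -- slope a / a₀.  Sums of a point of slope a / a₀ and one of slope a′ / a₀
      -- lie strictly between the two lines and determine their summands.
      between-lines : ∀ {a a′} → a ∈ D → a′ ∈ D → a <ᴿ a′ →
                      common a₀ a * common a₀ a′ ≤ count (between? a a′) points
      between-lines {a} {a′} a∈ a′∈ a<a′ = begin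
        length (line a) * length (line a′)                  ≡⟨ length-cartesianProduct (line a) (line a′) ⟨
        length (cartesianProduct (line a) (line a′))        ≤⟨ Pairs.pigeonhole-count {R = Sum} (between? a a′) Sum-injective
                                                                 (Unique.cartesianProduct⁺ setoid setoid (line! a) (line! a′))
                                                                 (All.map place (All-cartesianProduct (on-line a) (on-line a′))) ⟩
        count (between? a a′) points                        ∎
        where
        open ℕ.≤-Reasoning
        module Pairs = Pigeonhole (Pointwise.×-setoid setoid setoid)

        line! : ∀ a → Unique (line a)
        line! a = Unique.filter⁺ setoid (inRow? a) (row! a₀)

        on-line : ∀ a → All (λ p → InRow a₀ p × InRow a p) (line a)
        on-line a = All-filter (inRow? a) (All.all-filter (inRow? a₀) products)

        -- These are v = c + c′ multiplied by `a₀` and u = b + b′ multiplied by `a` and `a′`,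
        -- expressed through p = a b = a₀ c and p′ = a′ b′ = a₀ c′.
        Sum : Carrier × Carrier → Carrier × Carrier → Set _
        Sum (p , p′) (u , v) = a₀ *ᴿ v ≈ p +ᴿ p′ × a *ᴿ (a′ *ᴿ u) ≈ a′ *ᴿ p +ᴿ a *ᴿ p′

        Sum-injective : ∀ {x y z} → Sum x z → Sum y z → Pointwise.Pointwise _≈_ _≈_ x y
        Sum-injective {p , p′} {q , q′} {u , v} (v≈ , u≈) (v≈′ , u≈′) = p≈q , p′≈q′
          where
          e : Carrier
          e = a′ -ᴿ a
          -- Elimination of `r` from the two linear equations: (a′ - a) r′ = a′ a₀ v - a a′ u, with
          -- the subtracted term moved to the left. As a′ - a is positive, `r′` is determined.
          expand : ∀ r r′ → a₀ *ᴿ v ≈ r +ᴿ r′ → a *ᴿ (a′ *ᴿ u) ≈ a′ *ᴿ r +ᴿ a *ᴿ r′ →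
                   e *ᴿ r′ +ᴿ a *ᴿ (a′ *ᴿ u) ≈ a′ *ᴿ (a₀ *ᴿ v)
          expand r r′ v≈ u≈ = ≈-trans (+-congˡ (≈-trans u≈ (+-congʳ (*-congʳ (≈-sym (sub-add a′ a))))))
            (≈-trans (solve 4 (λ e a r r′ → e :* r′ :+ ((e :+ a) :* r :+ a :* r′) := (e :+ a) :* (r :+ r′)) ≈-refl e a r r′)
              (*-cong (sub-add a′ a) (≈-sym v≈)))
          p′≈q′ : p′ ≈ q′
          p′≈q′ = *-cancelˡ-pos (<⇒0<sub a<a′) (+-cancelʳ (a *ᴿ (a′ *ᴿ u))
            (≈-trans (expand p p′ v≈ u≈) (≈-sym (expand q q′ v≈′ u≈′))))
          p≈q : p ≈ q
          p≈q = +-cancelʳ q′ (≈-trans (+-congˡ (≈-sym p′≈q′)) (≈-trans (≈-sym v≈) v≈′))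

        place : ∀ {pp} → (InRow a₀ (proj₁ pp) × InRow a (proj₁ pp)) × (InRow a₀ (proj₂ pp) × InRow a′ (proj₂ pp)) →
                Any (Sum pp ∩ Between a a′) points
        place {p , p′} ((p∈a₀ , p∈a) , (p′∈a₀ , p′∈a′)) with find p∈a₀ | find p∈a | find p′∈a₀ | find p′∈a′
        ... | c , c∈ , p≈a₀c | b , b∈ , p≈ab | c′ , c′∈ , p′≈a₀c′ | b′ , b′∈ , p′≈a′b′ =
          Any.map (λ (u≈ , v≈) → good (≈-sym u≈) (≈-sym v≈)) (Any.cartesianProduct⁺
            (∈-dedup⁺ (∈-⊕⁺ b∈ b′∈ ≈-refl)) (∈-dedup⁺ (∈-⊕⁺ c∈ c′∈ ≈-refl)))
          where
          good : ∀ {u v} → u ≈ b +ᴿ b′ → v ≈ c +ᴿ c′ → (Sum (p , p′) ∩ Between a a′) (u , v)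
          good {u} {v} u≈ v≈ = (a₀v≈ , aa′u≈) , (0<u , au<a₀v) , λ (_ , a′u<a₀v) → asym a₀v<a′u a′u<a₀v
            where
            a₀v≈ : a₀ *ᴿ v ≈ p +ᴿ p′
            a₀v≈ = ≈-trans (*-congˡ v≈) (≈-trans (distribˡ a₀ c c′) (+-cong (≈-sym p≈a₀c) (≈-sym p′≈a₀c′)))
            aa′u≈ : a *ᴿ (a′ *ᴿ u) ≈ a′ *ᴿ p +ᴿ a *ᴿ p′
            aa′u≈ = ≈-trans (*-congˡ (*-congˡ u≈))
              (≈-trans (solve 4 (λ a a′ b b′ → a :* (a′ :* (b :+ b′)) := a′ :* (a :* b) :+ a :* (a′ :* b′)) ≈-refl a a′ b b′)
                (+-cong (*-congˡ (≈-sym p≈ab)) (*-congˡ (≈-sym p′≈a′b′))))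
            0<u : 0# <ᴿ u
            0<u = <-respʳ-≈ (≈-sym u≈) (+-pos (pos b∈) (pos b′∈))
            -- The mediant inequality: a u = p + a b′ < p + a′ b′ = a₀ v here, and a₀ v = a b + p′ <
            -- a′ b + p′ = a′ u below.
            au<a₀v : a *ᴿ u <ᴿ a₀ *ᴿ v
            au<a₀v = <-respˡ-≈ (≈-sym (≈-trans (*-congˡ u≈) (≈-trans (distribˡ a b b′) (+-congʳ (≈-sym p≈ab)))))
              (<-respʳ-≈ (≈-sym (≈-trans a₀v≈ (+-congˡ p′≈a′b′))) (+-monoʳ-<ᴿ p (*-monoʳ-<ᴿ (pos b′∈) a<a′)))
            a₀v<a′u : a₀ *ᴿ v <ᴿ a′ *ᴿ u
            a₀v<a′u = <-respˡ-≈ (≈-sym (≈-trans a₀v≈ (+-congʳ p≈ab)))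
              (<-respʳ-≈ (≈-sym (≈-trans (*-congˡ u≈) (≈-trans (distribˡ a′ b b′) (+-congˡ (≈-sym p′≈a′b′)))))
                (+ᴿ-monoˡ-< p′ (*-monoʳ-<ᴿ (pos b∈) a<a′)))

      -- By `energy` the average of `common a₀` over `D` is at least m² / π; the threshold is half
      -- of that.
      Popular : Carrier → Set
      Popular a = m * m ≤ 2 * π * common a₀ a

      popular? : Decidable Popular
      popular? a = m * m ℕ.≤? 2 * π * common a₀ a

      -- Each pair of consecutive popular slopes accounts for at least (m² / 2π)² grid points in its
      -- own sector, and the sectors stack disjointly above the line of slope a / a₀. The entries of
      -- `T` count the gaps, one fewer than the slopes.
      popular-chain : ∀ a T → AllPairs _<ᴿ_ (a ∷ T) → All (λ a → a ∈ D × Popular a) (a ∷ T) →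
                      length T * (m * m * (m * m)) ≤ 4 * (π * π) * count (above? a) points
      popular-chain a []       _                           _                          = z≤n
      popular-chain a (a′ ∷ T) ((a<a′ ∷ _) ∷ sorted′) ((a∈ , a-pop) ∷ ps@((a′∈ , a′-pop) ∷ _)) = begin
        m * m * (m * m) + length T * (m * m * (m * m))
          ≤⟨ ℕ.+-mono-≤ (ℕ.*-mono-≤ a-pop a′-pop) (popular-chain a′ T sorted′ ps) ⟩
        2 * π * common a₀ a * (2 * π * common a₀ a′) + 4 * (π * π) * count (above? a′) points
          ≡⟨ lem π (common a₀ a) (common a₀ a′) (count (above? a′) points) ⟩
        4 * (π * π) * (common a₀ a * common a₀ a′ + count (above? a′) points)
          ≤⟨ ℕ.*-monoʳ-≤ (4 * (π * π)) (ℕ.+-monoˡ-≤ (count (above? a′) points) (between-lines a∈ a′∈ a<a′)) ⟩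
        4 * (π * π) * (count (between? a a′) points + count (above? a′) points)
          ≤⟨ ℕ.*-monoʳ-≤ (4 * (π * π)) (count-disjoint (between? a a′) (above? a′) (above? a) proj₁ steeper (λ (_ , ¬q) q → ¬q q) points) ⟩
        4 * (π * π) * count (above? a) points ∎
        where
        open ℕ.≤-Reasoning
        lem : ∀ π i j k → 2 * π * i * (2 * π * j) + 4 * (π * π) * k ≡ 4 * (π * π) * (i * j + k)
        lem = solve-∀
        steeper : ∀ {q} → Above a′ q → Above a q
        steeper (0<u , a′u<a₀v) = 0<u , <ᴿ-trans (*-monoʳ-<ᴿ 0<u a<a′) a′u<a₀v

      -- The additional m⁴ on the right pays for the slope that opens no sector.
      count-popular : count popular? D * (m * m * (m * m)) ≤ m * m * (m * m) + 4 * (π * π) * (σ * σ)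
      count-popular = go (filter popular? D) (AllPairs.filter⁺ popular? sorted) (All-filter popular? (All-∈ id))
        where
        open ℕ.≤-Reasoning
        go : ∀ T → AllPairs _<ᴿ_ T → All (λ a → a ∈ D × Popular a) T →
             length T * (m * m * (m * m)) ≤ m * m * (m * m) + 4 * (π * π) * (σ * σ)
        go []      _       _  = z≤n
        go (a ∷ T) sorted′ ps = ℕ.+-monoʳ-≤ (m * m * (m * m)) (begin
          length T * (m * m * (m * m))             ≤⟨ popular-chain a T sorted′ ps ⟩
          4 * (π * π) * count (above? a) points    ≤⟨ ℕ.*-monoʳ-≤ (4 * (π * π)) (length-filter (above? a) points) ⟩
          4 * (π * π) * length points              ≡⟨ ≡.cong (4 * (π * π) *_) (length-cartesianProduct (dedup (D ⊕ D)) (dedup (D ⊕ D))) ⟩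
          4 * (π * π) * (σ * σ)                    ∎)

      m≤π : m ≤ π
      m≤π = ℕ.≤-trans (m≤row a₀∈) (length-filter (inRow? a₀) products)

      m≤σ : m ≤ σ
      m≤σ = pigeonhole {R = λ x y → x +ᴿ a₀ ≈ y} (λ p q → +-cancelʳ a₀ (≈-trans p (≈-sym q))) D!
        (All-∈ (λ x∈ → ∈-dedup⁺ (∈-⊕⁺ x∈ a₀∈ ≈-refl)))

      -- Unpopular slopes contribute at most half of the guaranteed sum m³ / π, and a popular one at
      -- most `m`; hence at least m² / 2π slopes are popular.
      many-popular : 0 < m → m * m * m ≤ π * ∑ D (common a₀) → m * m ≤ 2 * π * count popular? D
      many-popular 0<m energetic = ℕ.*-cancelˡ-≤ m {{ℕ.>-nonZero 0<m}} (ℕ.+-cancelˡ-≤ (m * (m * m)) _ _ (begin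
        m * (m * m) + m * (m * m)                   ≡⟨ lem m ⟩
        2 * (m * m * m)                             ≤⟨ ℕ.*-monoʳ-≤ 2 energetic ⟩
        2 * (π * ∑ D (common a₀))                   ≡⟨ ℕ.*-assoc 2 π _ ⟨
        2 * π * ∑ D (common a₀)                     ≤⟨ ∑-popular popular? (common a₀) (2 * π) (m * m) m D
                                                         (All.universal (common≤m a₀) D) (All.universal (λ a ¬pop → ℕ.<⇒≤ (ℕ.≰⇒> ¬pop)) D) ⟩
        m * (m * m) + count popular? D * (2 * π * m) ≡⟨ ≡.cong (m * (m * m) +_) (lem′ (count popular? D) (2 * π) m) ⟩
        m * (m * m) + m * (2 * π * count popular? D) ∎))
        where
        open ℕ.≤-Reasoning
        lem : ∀ m → m * (m * m) + m * (m * m) ≡ 2 * (m * m * m)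
        lem = solve-∀
        lem′ : ∀ i j k → i * (j * k) ≡ k * (j * i)
        lem′ = solve-∀

    sum-product : m ^ 6 ≤ 10 * (π ^ 3 * σ ^ 2)
    sum-product with energy
    ... | inj₁ m≡0 = ℕ.≤-trans (ℕ.≤-reflexive (≡.cong (_^ 6) m≡0)) z≤n
    ... | inj₂ (a₀ , a₀∈ , energetic) = begin
      m ^ 6                                                ≡⟨ lem₁ m ⟩
      m * m * (m * m * (m * m))                            ≤⟨ ℕ.*-monoˡ-≤ (m * m * (m * m)) (many-popular 0<m energetic) ⟩
      2 * π * count popular? D * (m * m * (m * m))         ≡⟨ ℕ.*-assoc (2 * π) (count popular? D) _ ⟩
      2 * π * (count popular? D * (m * m * (m * m)))       ≤⟨ ℕ.*-monoʳ-≤ (2 * π) count-popular ⟩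
      -- The term m⁴ of the missing sector is absorbed into π² σ², whence the constant 2 (1 + 4) =
      -- 10.
      2 * π * (m * m * (m * m) + 4 * (π * π) * (σ * σ))    ≤⟨ ℕ.*-monoʳ-≤ (2 * π) (ℕ.+-monoˡ-≤ (4 * (π * π) * (σ * σ))
                                                                (ℕ.*-mono-≤ (ℕ.*-mono-≤ m≤π m≤π) (ℕ.*-mono-≤ m≤σ m≤σ))) ⟩
      2 * π * (π * π * (σ * σ) + 4 * (π * π) * (σ * σ))    ≡⟨ lem₂ π σ ⟩
      10 * (π ^ 3 * σ ^ 2)                                 ∎
      where
      open ℕ.≤-Reasoning
      open Slopes a₀∈
      0<m : 0 < m
      0<m = nonempty a₀∈
        where
        nonempty : ∀ {x xs} → x ∈ xs → 0 < length xs
        nonempty (here _)  = s≤s z≤n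
        nonempty (there _) = s≤s z≤n
      lem₁ : ∀ m → m * (m * (m * (m * (m * (m * 1))))) ≡ m * m * (m * m * (m * m))
      lem₁ = solve-∀
      lem₂ : ∀ π σ → 2 * π * (π * π * (σ * σ) + 4 * (π * π) * (σ * σ)) ≡ 10 * (π * (π * (π * 1)) * (σ * (σ * 1)))
      lem₂ = solve-∀

-- Squared differences of `A`: products against distances.

-- Here `w`, `v`, `z`, `d` are the sizes of `Z ⊕ D₀ ⊕ D₀`, `Z ⊕ D₀`, `Z`, `D₀`. The last three
-- hypotheses are Ruzsa's triangle inequality, Petridis's inequality and the ratio of `Z`. With
-- division they give π ≤ w² / z ≤ v⁴ / z³ ≤ s⁴ z / d⁴ ≤ s⁴ / d³, the last step by z ≤ d; the factor
-- z³ d clears the denominators.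
ruzsa-petridis-bound : ∀ π w v s z d → 0 < z → z ≤ d → π * z ≤ w * w → w * z ≤ v * v → v * d ≤ s * z →
                       π * (d * d * d) ≤ s * s * (s * s)
ruzsa-petridis-bound π w v s z d 0<z z≤d πz≤ wz≤ vd≤ = ℕ.*-cancelʳ-≤ _ _ (z * z * z * d) {{nonzero}} (begin
  π * (d * d * d) * (z * z * z * d)                    ≡⟨ lem₁ π d z ⟩
  π * z * (z * z * (d * d * (d * d)))                  ≤⟨ ℕ.*-monoˡ-≤ _ πz≤ ⟩
  w * w * (z * z * (d * d * (d * d)))                  ≡⟨ lem₂ w d z ⟩
  w * z * (w * z) * (d * d * (d * d))                  ≤⟨ ℕ.*-monoˡ-≤ _ (ℕ.*-mono-≤ wz≤ wz≤) ⟩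
  v * v * (v * v) * (d * d * (d * d))                  ≡⟨ lem₃ v d ⟩
  v * d * (v * d) * (v * d * (v * d))                  ≤⟨ ℕ.*-mono-≤ (ℕ.*-mono-≤ vd≤ vd≤) (ℕ.*-mono-≤ vd≤ vd≤) ⟩
  s * z * (s * z) * (s * z * (s * z))                  ≡⟨ lem₄ s z ⟩
  s * s * (s * s) * (z * z * z * z)                    ≤⟨ ℕ.*-monoʳ-≤ (s * s * (s * s)) (ℕ.*-monoʳ-≤ (z * z * z) z≤d) ⟩
  s * s * (s * s) * (z * z * z * d)                    ∎)
  where
  open ℕ.≤-Reasoning
  instance
    z≢0 : NonZero z
    z≢0 = ℕ.>-nonZero 0<z
    d≢0 : NonZero d
    d≢0 = ℕ.>-nonZero (ℕ.<-≤-trans 0<z z≤d)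
  nonzero : NonZero (z * z * z * d)
  nonzero = ℕ.m*n≢0 (z * z * z) d {{ℕ.m*n≢0 (z * z) z {{ℕ.m*n≢0 z z}}}}
  lem₁ : ∀ π d z → π * (d * d * d) * (z * z * z * d) ≡ π * z * (z * z * (d * d * (d * d)))
  lem₁ = solve-∀
  lem₂ : ∀ w d z → w * w * (z * z * (d * d * (d * d))) ≡ w * z * (w * z) * (d * d * (d * d))
  lem₂ = solve-∀
  lem₃ : ∀ v d → v * v * (v * v) * (d * d * (d * d)) ≡ v * d * (v * d) * (v * d * (v * d))
  lem₃ = solve-∀
  lem₄ : ∀ s z → s * z * (s * z) * (s * z * (s * z)) ≡ s * s * (s * s) * (z * z * z * z)
  lem₄ = solve-∀

module Distances {c ℓ₁ ℓ₂} (ℝ : Reals c ℓ₁ ℓ₂) (A : List (Reals.Carrier ℝ)) where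
  open OrderedField ℝ
  open Plane ℝ using (Δ; sqDist)
  open SumProduct ℝ
  open Sumset +-abelianGroup _≟_

  distances : List Carrier
  distances = Δ (cartesianProduct A A)

  squares : List Carrier
  squares = cartesianProductWith (λ x y → sq (x -ᴿ y)) A A

  D₀ : List Carrier
  D₀ = dedup squares

  sub-cong : ∀ {x y z w} → x ≈ y → z ≈ w → x -ᴿ z ≈ y -ᴿ w
  sub-cong x≈y z≈w = +-cong x≈y (-‿cong z≈w)

  sq-cong : ∀ {x y} → x ≈ y → sq x ≈ sq y
  sq-cong x≈y = *-cong x≈y x≈y

  ∈-D₀⁺ : ∀ {x a b} → a ∈ A → b ∈ A → x ≈ sq (a -ᴿ b) → x ∈ D₀
  ∈-D₀⁺ a∈ b∈ x≈ = ∈-dedup⁺ (Membership.∈-resp-≈ setoid (≈-sym x≈)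
    (Membership.∈-cartesianProductWith⁺ setoid setoid setoid (λ x≈y z≈w → sq-cong (sub-cong x≈y z≈w)) a∈ b∈))

  ∈-D₀⁻ : ∀ {x} → x ∈ D₀ → ∃[ a ] ∃[ b ] (a ∈ A × b ∈ A × x ≈ sq (a -ᴿ b))
  ∈-D₀⁻ x∈ = Membership.∈-cartesianProductWith⁻ setoid setoid setoid (λ x y → sq (x -ᴿ y)) A A (∈-dedup⁻ squares x∈)

  -- (a - b)² + (a′ - b′)² is the squared distance between the grid points `(a , a′)` and
  -- `(b , b′)`.
  D₀⊕D₀⊆distances : ∀ {x} → x ∈ D₀ ⊕ D₀ → x ∈ distances
  D₀⊕D₀⊆distances x∈ with ∈-⊕⁻ D₀ D₀ x∈
  ... | y , y′ , y∈ , y′∈ , x≈ with ∈-D₀⁻ y∈ | ∈-D₀⁻ y′∈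
  ...   | a , b , a∈ , b∈ , y≈ | a′ , b′ , a′∈ , b′∈ , y′≈ = ∈-dedup⁺ (Any.cartesianProductWith⁺ sqDist
          (λ (a≈ , a′≈) (b≈ , b′≈) → ≈-trans x≈ (+-cong (≈-trans y≈ (sq-cong (sub-cong a≈ b≈))) (≈-trans y′≈ (sq-cong (sub-cong a′≈ b′≈)))))
          (Any.cartesianProduct⁺ a∈ a′∈) (Any.cartesianProduct⁺ b∈ b′∈))

  private
    positive-squares : ∃[ ys ] (AllPairs _<ᴿ_ ys × SameElements (filter (0# <?_) D₀) ys)
    positive-squares = sorted-set (filter (0# <?_) D₀)

  -- Two versions of the set of squares are kept. `D₀` may contain zero, as the rectangle identity
  -- uses squares such as (b - x)² that can vanish; Solymosi's argument needs positive numbers in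
  -- increasing order, which `D` provides.
  D : List Carrier
  D = proj₁ positive-squares

  sorted : AllPairs _<ᴿ_ D
  sorted = proj₁ (proj₂ positive-squares)

  ∈-D⁻ : ∀ {x} → x ∈ D → x ∈ D₀ × 0# <ᴿ x
  ∈-D⁻ x∈ = Membership.∈-filter⁻ setoid (0# <?_) <-respʳ-≈ {xs = D₀} (proj₂ (proj₂ (proj₂ positive-squares)) x∈)

  ∈-D⁺ : ∀ {x} → x ∈ D₀ → 0# <ᴿ x → x ∈ D
  ∈-D⁺ x∈ 0<x = proj₁ (proj₂ (proj₂ positive-squares)) (Membership.∈-filter⁺ setoid (0# <?_) <-respʳ-≈ x∈ 0<x)

  open Rows D sorted (All-∈ (proj₂ ∘ ∈-D⁻)) using (D!; sum-product)

  card-D₀⊕D₀ : card (D₀ ⊕ D₀) ≤ length distances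
  card-D₀⊕D₀ = pigeonhole-⊆ (dedup-! (D₀ ⊕ D₀)) (D₀⊕D₀⊆distances ∘ ∈-dedup⁻ (D₀ ⊕ D₀))

  card-D⊕D : card (D ⊕ D) ≤ length distances
  card-D⊕D = ℕ.≤-trans (card-⊆ sub) card-D₀⊕D₀
    where
    sub : ∀ {x} → x ∈ D ⊕ D → x ∈ D₀ ⊕ D₀
    sub x∈ with ∈-⊕⁻ D D x∈
    ... | y , z , y∈ , z∈ , x≈ = ∈-⊕⁺ (proj₁ (∈-D⁻ y∈)) (proj₁ (∈-D⁻ z∈)) x≈

  length-D≤ : length D ≤ length D₀
  length-D≤ = pigeonhole-⊆ D! (proj₁ ∘ ∈-D⁻)

  double : Carrier → Carrier
  double x = x +ᴿ x

  double-injective : ∀ {x y} → double x ≈ double y → x ≈ y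
  double-injective {x} {y} eq = *-cancelˡ-pos 0<2 (≈-trans (lem x) (≈-trans eq (≈-sym (lem y))))
    where
    lem : ∀ x → (1# +ᴿ 1#) *ᴿ x ≈ x +ᴿ x
    lem x = ≈-trans (distribʳ x 1# 1#) (+-cong (*-identityˡ x) (*-identityˡ x))

  sq-double : ∀ x → sq (double x) ≈ double (double (sq x))
  sq-double x = solve 1 (λ x → (x :+ x) :* (x :+ x) := (x :* x :+ x :* x) :+ (x :* x :+ x :* x)) ≈-refl x

  -- In terms of t = a - b, q = b - x and k = x - y the other differences are t + q, q + k and t + q
  -- + k, and the identity becomes one between polynomials without subtraction.
  rectangle : ∀ a b x y → sq (b -ᴿ x) +ᴿ sq (a -ᴿ y) ≈ double ((a -ᴿ b) *ᴿ (x -ᴿ y)) +ᴿ (sq (a -ᴿ x) +ᴿ sq (b -ᴿ y))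
  rectangle a b x y = ≈-trans (+-congˡ (sq-cong (≈-sym a-y))) (≈-trans
    (solve 3 (λ q t k → q :* q :+ (t :+ q :+ k) :* (t :+ q :+ k) :=
                        (t :* k :+ t :* k) :+ ((t :+ q) :* (t :+ q) :+ (q :+ k) :* (q :+ k))) ≈-refl (b -ᴿ x) (a -ᴿ b) (x -ᴿ y))
    (+-congˡ (+-cong (sq-cong (telescope a b x)) (sq-cong (telescope b x y)))))
    where
    a-y : (a -ᴿ b) +ᴿ (b -ᴿ x) +ᴿ (x -ᴿ y) ≈ a -ᴿ y
    a-y = ≈-trans (+-congʳ (telescope a b x)) (telescope a x y)

  -- Ruzsa's triangle inequality: by the identity above, 2 (a - b) (x - y) is a
  -- difference of two elements of D₀ ⊕ D₀, and translating both by Z gives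
  -- ∣Z∣ representations inside Z ⊕ D₀ ⊕ D₀.
  card-D⊗D : ∀ {Z} → Unique Z → card (D ⊗ D) * length Z ≤ card (Z ⊕ D₀ ⊕ D₀) * card (Z ⊕ D₀ ⊕ D₀)
  card-D⊗D {Z} Z! = ℕ.≤-trans
    (fibres difference? (λ p q → double-injective (double-injective (≈-trans (≈-sym p) q)))
      (cartesianProduct W W) (dedup-! (D ⊗ D)) (All-∈ (λ e∈ → translates (∈-dedup⁻ (D ⊗ D) e∈))))
    (ℕ.≤-reflexive (length-cartesianProduct W W))
    where
    W : List Carrier
    W = dedup (Z ⊕ D₀ ⊕ D₀)
    -- An element `e` of `D ⊗ D` is t² for a product t of two differences, and g - h = 2 t.
    -- Recording (g - h)² = 4 e makes the pair determine `e` with neither a square root nor a choice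
    -- of sign for t.
    Difference : Carrier → Carrier × Carrier → Set _
    Difference e (g , h) = sq (g -ᴿ h) ≈ double (double e)
    difference? : ∀ e → Decidable (Difference e)
    difference? e (g , h) = sq (g -ᴿ h) ≟ double (double e)
    ∈-W : ∀ {z x y} → z ∈ Z → x ∈ D₀ → y ∈ D₀ → z +ᴿ (x +ᴿ y) ∈ W
    ∈-W {z} {x} {y} z∈ x∈ y∈ = ∈-dedup⁺ (∈-⊕⁺ (∈-⊕⁺ z∈ x∈ ≈-refl) y∈ (≈-sym (+-assoc z x y)))
    translates : ∀ {e} → e ∈ D ⊗ D → length Z ≤ count (difference? e) (cartesianProduct W W)
    translates {e} e∈ with Membership.∈-cartesianProductWith⁻ setoid setoid setoid _*ᴿ_ D D e∈
    ... | d , d′ , d∈ , d′∈ , e≈ with ∈-D₀⁻ (proj₁ (∈-D⁻ d∈)) | ∈-D₀⁻ (proj₁ (∈-D⁻ d′∈))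
    ...   | a , b , a∈ , b∈ , d≈ | x , y , x∈ , y∈ , d′≈ =
      pigeonhole-count {R = λ z (g , h) → z +ᴿ w ≈ g} (difference? e) (λ p q → +-cancelʳ w (≈-trans p (≈-sym q))) Z!
        (All-∈ (λ z∈ → Any.map (λ (g≈ , h≈) → g≈ , represents (≈-sym g≈) (≈-sym h≈))
          (Any.cartesianProduct⁺ (∈-W z∈ (∈-D₀⁺ b∈ x∈ ≈-refl) (∈-D₀⁺ a∈ y∈ ≈-refl))
                                 (∈-W z∈ (∈-D₀⁺ a∈ x∈ ≈-refl) (∈-D₀⁺ b∈ y∈ ≈-refl)))))
      where
      w u t : Carrier
      w = sq (b -ᴿ x) +ᴿ sq (a -ᴿ y)
      u = sq (a -ᴿ x) +ᴿ sq (b -ᴿ y)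
      t = (a -ᴿ b) *ᴿ (x -ᴿ y)
      represents : ∀ {z g h} → g ≈ z +ᴿ w → h ≈ z +ᴿ u → Difference e (g , h)
      represents {z} {g} {h} g≈ h≈ = ≈-trans (sq-cong (≈-sub g≈′)) (≈-trans (sq-double t) (+-cong (+-cong e≈′ e≈′) (+-cong e≈′ e≈′)))
        where
        g≈′ : g ≈ double t +ᴿ h
        g≈′ = ≈-trans g≈ (≈-trans (+-congˡ (rectangle a b x y))
          (≈-trans (solve 3 (λ z d u → z :+ (d :+ u) := d :+ (z :+ u)) ≈-refl z (double t) u) (+-congˡ (≈-sym h≈))))
        e≈′ : sq t ≈ e
        e≈′ = ≈-trans (solve 2 (λ i j → (i :* j) :* (i :* j) := (i :* i) :* (j :* j)) ≈-refl (a -ᴿ b) (x -ᴿ y))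
          (≈-sym (≈-trans e≈ (*-cong d≈ d′≈)))

  card-D⊗D-bound : card (D ⊗ D) * (length D * length D * length D) ≤
                   length distances * length distances * (length distances * length distances)
  card-D⊗D-bound = decidable-stable (_ ℕ.≤? _) (λ ¬bound → ¬bound (main ¬bound))
    where
    open ℕ.≤-Reasoning
    π d s : ℕ
    π = card (D ⊗ D)
    d = length D₀
    s = length distances
    weaken : π * (d * d * d) ≤ s * s * (s * s) → π * (length D * length D * length D) ≤ s * s * (s * s)
    weaken = ℕ.≤-trans (ℕ.*-monoʳ-≤ π (ℕ.*-mono-≤ (ℕ.*-mono-≤ length-D≤ length-D≤) length-D≤))
    main : ¬ (π * (length D * length D * length D) ≤ s * s * (s * s)) → π * (length D * length D * length D) ≤ s * s * (s * s)
    main ¬bound with length D₀ ℕ.≟ 0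
    -- An empty `D₀` has no nonempty subset `Z`, but the left side is then zero.
    ... | yes d≡0 = weaken (ℕ.≤-trans (ℕ.≤-reflexive (≡.trans (≡.cong (λ d → π * (d * d * d)) d≡0) (ℕ.*-zeroʳ π))) z≤n)
    ... | no d≢0  = ⊥-elim (¬¬-petridis D₀ (dedup-! squares) (ℕ.n≢0⇒n>0 d≢0)
      λ (Z , Z! , 0<Z , Z≤D₀ , ratio , expansion) → ¬bound (weaken
        (ruzsa-petridis-bound π (card (Z ⊕ D₀ ⊕ D₀)) (card (Z ⊕ D₀)) s (length Z) d 0<Z Z≤D₀ (card-D⊗D Z!) (expansion D₀)
          (ℕ.≤-trans ratio (ℕ.*-monoˡ-≤ (length Z) card-D₀⊕D₀)))))

  -- Writing m¹⁵ = m⁶ m⁹ supplies an m³ for each of the three factors π of `sum-product`; every π m³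
  -- is at most s⁴ and σ² is at most s², in total s¹⁴.
  squares-bound : length D ^ 15 ≤ 10 * length distances ^ 14
  squares-bound = begin
    m ^ 15                                        ≡⟨ ℕ.^-distribˡ-+-* m 6 9 ⟩
    m ^ 6 * m ^ 9                                 ≤⟨ ℕ.*-monoˡ-≤ (m ^ 9) sum-product ⟩
    10 * (π ^ 3 * σ ^ 2) * m ^ 9                  ≡⟨ lem₁ π σ m ⟩
    10 * (π * (m * m * m) * (π * (m * m * m)) * (π * (m * m * m)) * (σ * σ))
      ≤⟨ ℕ.*-monoʳ-≤ 10 (ℕ.*-mono-≤ (ℕ.*-mono-≤ (ℕ.*-mono-≤ card-D⊗D-bound card-D⊗D-bound) card-D⊗D-bound) (ℕ.*-mono-≤ card-D⊕D card-D⊕D)) ⟩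
    10 * (s * s * (s * s) * (s * s * (s * s)) * (s * s * (s * s)) * (s * s)) ≡⟨ ≡.cong (10 *_) (lem₂ s) ⟩
    10 * s ^ 14                                   ∎
    where
    open ℕ.≤-Reasoning
    m π σ s : ℕ
    m = length D
    π = card (D ⊗ D)
    σ = card (D ⊕ D)
    s = length distances
    lem₁ : ∀ π σ m → 10 * (π * (π * (π * 1)) * (σ * (σ * 1))) * (m * (m * (m * (m * (m * (m * (m * (m * (m * 1))))))))) ≡
                     10 * (π * (m * m * m) * (π * (m * m * m)) * (π * (m * m * m)) * (σ * σ))
    lem₁ = solve-∀
    lem₂ : ∀ s → s * s * (s * s) * (s * s * (s * s)) * (s * s * (s * s)) * (s * s) ≡
                 s * (s * (s * (s * (s * (s * (s * (s * (s * (s * (s * (s * (s * (s * 1)))))))))))))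
    lem₂ = solve-∀

  differences : List Carrier
  differences = dedup (cartesianProductWith _-ᴿ_ A A)

  -- x is recovered from x² and its sign.
  length-differences : length differences ≤ (1 + length D) * 2
  length-differences = ℕ.≤-trans (pigeonhole {R = SquareAndSign} recover (dedup-! _)
      (All-∈ (λ x∈ → locate (Membership.∈-cartesianProductWith⁻ setoid setoid setoid _-ᴿ_ A A (∈-dedup⁻ (cartesianProductWith _-ᴿ_ A A) x∈)))))
    (ℕ.≤-reflexive (length-cartesianProduct (0# ∷ D) (true ∷ false ∷ [])))
    where
    SquareAndSign : Carrier → Carrier × Bool → Set _
    SquareAndSign x (d , b) = sq x ≈ d × does (0# <? x) ≡ b
    same-sign : ∀ {x y} → does (0# <? x) ≡ does (0# <? y) → 0# <ᴿ x → 0# <ᴿ y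
    same-sign {x} {y} eq 0<x with 0# <? x | 0# <? y
    same-sign eq 0<x | _      | yes 0<y = 0<y
    same-sign eq 0<x | no ¬0<x | no _   = contradiction 0<x ¬0<x
    same-sign () 0<x | yes _  | no _
    recover : ∀ {x x′ y} → SquareAndSign x y → SquareAndSign x′ y → x ≈ x′
    recover (sx , bx) (sx′ , bx′) = sq-injective (same-sign (≡.trans bx (≡.sym bx′))) (same-sign (≡.trans bx′ (≡.sym bx))) (≈-trans sx (≈-sym sx′))
    any-bool : ∀ b → Any (b ≡_) (true ∷ false ∷ [])
    any-bool true  = here ≡.refl
    any-bool false = there (here ≡.refl)
    square∈ : ∀ {x} → ∃[ a ] ∃[ b ] (a ∈ A × b ∈ A × x ≈ a -ᴿ b) → sq x ∈ 0# ∷ D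
    square∈ {x} (a , b , a∈ , b∈ , x≈) with x ≟ 0#
    ... | yes x≈0 = here (≈-trans (*-congʳ x≈0) (zeroˡ x))
    ... | no x≉0  = there (∈-D⁺ (∈-D₀⁺ a∈ b∈ (sq-cong x≈)) (sq-pos x≉0))
    locate : ∀ {x} → ∃[ a ] ∃[ b ] (a ∈ A × b ∈ A × x ≈ a -ᴿ b) → Any (SquareAndSign x) (cartesianProduct (0# ∷ D) (true ∷ false ∷ []))
    locate {x} x∈ = Any.cartesianProduct⁺ (square∈ x∈) (any-bool (does (0# <? x)))

-- Arithmetic of exponents and constants.

^-distribʳ-* : ∀ x y n → (x * y) ^ n ≡ x ^ n * y ^ n
^-distribʳ-* x y zero    = ≡.refl
^-distribʳ-* x y (suc n) = ≡.trans (≡.cong (x * y *_) (^-distribʳ-* x y n)) (interchange x y (x ^ n) (y ^ n))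
  where
  interchange : ∀ i j k l → i * j * (k * l) ≡ i * k * (j * l)
  interchange = solve-∀

pow-cancel-≤ : ∀ k {x y} .{{_ : NonZero k}} → x ^ k ≤ y ^ k → x ≤ y
pow-cancel-≤ k {x} {y} xᵏ≤yᵏ with x ℕ.≤? y
... | yes x≤y = x≤y
... | no x≰y  = contradiction xᵏ≤yᵏ (ℕ.<⇒≱ (ℕ.^-monoˡ-< k (ℕ.≰⇒> x≰y)))

-- The k/i-th power of the hypothesis.
pow-transfer : ∀ i j k l {c x y} .{{_ : NonZero i}} → 0 < c → 0 < y → j * k ≤ l * i → x ^ i ≤ c * y ^ j → x ^ k ≤ c ^ k * y ^ l
pow-transfer i j k l {c} {x} {y} 0<c 0<y jk≤li xⁱ≤ = pow-cancel-≤ i (begin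
  (x ^ k) ^ i                ≡⟨ pow-comm x k i ⟩
  (x ^ i) ^ k                ≤⟨ ℕ.^-monoˡ-≤ k xⁱ≤ ⟩
  (c * y ^ j) ^ k            ≡⟨ ^-distribʳ-* c (y ^ j) k ⟩
  c ^ k * (y ^ j) ^ k        ≡⟨ ≡.cong (c ^ k *_) (ℕ.^-*-assoc y j k) ⟩
  c ^ k * y ^ (j * k)        ≤⟨ ℕ.*-mono-≤ (m≤m^n (c ^ k) {{ℕ.m^n≢0 c k}}) (ℕ.^-monoʳ-≤ y jk≤li) ⟩
  (c ^ k) ^ i * y ^ (l * i)  ≡⟨ ≡.cong ((c ^ k) ^ i *_) (ℕ.^-*-assoc y l i) ⟨
  (c ^ k) ^ i * (y ^ l) ^ i  ≡⟨ ^-distribʳ-* (c ^ k) (y ^ l) i ⟨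
  (c ^ k * y ^ l) ^ i        ∎)
  where
  open ℕ.≤-Reasoning
  instance
    c≢0 : NonZero c
    c≢0 = ℕ.>-nonZero 0<c
    y≢0 : NonZero y
    y≢0 = ℕ.>-nonZero 0<y
  pow-comm : ∀ x k i → (x ^ k) ^ i ≡ (x ^ i) ^ k
  pow-comm x k i = ≡.trans (ℕ.^-*-assoc x k i) (≡.trans (≡.cong (x ^_) (ℕ.*-comm k i)) (≡.sym (ℕ.^-*-assoc x i k)))
  m≤m^n : ∀ m .{{_ : NonZero m}} → m ≤ m ^ i
  m≤m^n m = ℕ.≤-trans (ℕ.≤-reflexive (≡.sym (ℕ.*-identityʳ m))) (ℕ.^-monoʳ-≤ m (ℕ.>-nonZero⁻¹ i))

-- The 15th power of `N` is of order n²⁸. Passing to exponents 8 and 15 is possible because 28 · 8 =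
-- 224 ≤ 225 = 15 · 15.
differences-arith : ∀ C m {s n N} → 0 < n → s ≤ C * n ^ 2 → m ^ 15 ≤ 10 * s ^ 14 → N ≤ (1 + m) * 2 →
                    N ^ 8 ≤ ((C ^ 14 * 10 + 1) * 4 ^ 15) ^ 8 * n ^ 15
differences-arith C m {s} {n} {N} 0<n s≤ m¹⁵≤ N≤ =
  pow-transfer 15 28 8 15 {(C ^ 14 * 10 + 1) * 4 ^ 15} {N} {n} (ℕ.*-mono-≤ {1} {C ^ 14 * 10 + 1} {1} {4 ^ 15} (ℕ.m≤n+m 1 (C ^ 14 * 10)) (ℕ.m^n>0 4 15)) 0<n (ℕ.n≤1+n 224) (begin
    N ^ 15                                      ≤⟨ ℕ.^-monoˡ-≤ 15 (ℕ.≤-trans N≤ 2+2m≤4[m⊔1]) ⟩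
    ((m ℕ.⊔ 1) * 4) ^ 15                          ≡⟨ ^-distribʳ-* (m ℕ.⊔ 1) 4 15 ⟩
    (m ℕ.⊔ 1) ^ 15 * 4 ^ 15                     ≤⟨ ℕ.*-monoˡ-≤ (4 ^ 15) bound ⟩
    (C ^ 14 * 10 + 1) * n ^ 28 * 4 ^ 15         ≡⟨ swap (C ^ 14 * 10 + 1) (n ^ 28) (4 ^ 15) ⟩
    (C ^ 14 * 10 + 1) * 4 ^ 15 * n ^ 28         ∎)
  where
  open ℕ.≤-Reasoning
  instance
    n≢0 : NonZero n
    n≢0 = ℕ.>-nonZero 0<n
  swap : ∀ i j k → i * j * k ≡ i * k * j
  swap = solve-∀
  -- The maximum with 1 absorbs the summand 1 even for `m` zero, at the price of the factor 4. The
  -- `+ 1` next to `C ^ 14 * 10` covers the case `m ≤ 1` and keeps the constant positive when `C` is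
  -- zero.
  2+2m≤4[m⊔1] : (1 + m) * 2 ≤ (m ℕ.⊔ 1) * 4
  2+2m≤4[m⊔1] = begin
    (1 + m) * 2                         ≤⟨ ℕ.*-monoˡ-≤ 2 (ℕ.+-mono-≤ (ℕ.m≤n⊔m m 1) (ℕ.m≤m⊔n m 1)) ⟩
    ((m ℕ.⊔ 1) + (m ℕ.⊔ 1)) * 2             ≡⟨ lem (m ℕ.⊔ 1) ⟩
    (m ℕ.⊔ 1) * 4                       ∎
    where
    lem : ∀ k → (k + k) * 2 ≡ k * 4
    lem = solve-∀
  bound : (m ℕ.⊔ 1) ^ 15 ≤ (C ^ 14 * 10 + 1) * n ^ 28
  bound with ℕ.≤-total m 1
  ... | inj₁ m≤1 = begin
    (m ℕ.⊔ 1) ^ 15                    ≡⟨ ≡.cong (_^ 15) (ℕ.m≤n⇒m⊔n≡n m≤1) ⟩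
    1 ^ 15                            ≤⟨ ℕ.*-mono-≤ {1} {C ^ 14 * 10 + 1} (ℕ.m≤n+m 1 (C ^ 14 * 10)) (ℕ.m^n>0 n 28) ⟩
    (C ^ 14 * 10 + 1) * n ^ 28        ∎
  ... | inj₂ 1≤m = begin
    (m ℕ.⊔ 1) ^ 15                    ≡⟨ ≡.cong (_^ 15) (ℕ.m≥n⇒m⊔n≡m 1≤m) ⟩
    m ^ 15                            ≤⟨ m¹⁵≤ ⟩
    10 * s ^ 14                       ≡⟨ ℕ.*-comm 10 (s ^ 14) ⟩
    s ^ 14 * 10                       ≤⟨ ℕ.*-monoˡ-≤ 10 (ℕ.^-monoˡ-≤ 14 s≤) ⟩
    (C * n ^ 2) ^ 14 * 10             ≡⟨ ≡.cong (_* 10) (≡.trans (^-distribʳ-* C (n ^ 2) 14) (≡.cong (C ^ 14 *_) (ℕ.^-*-assoc n 2 14))) ⟩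
    C ^ 14 * n ^ 28 * 10              ≡⟨ swap (C ^ 14) (n ^ 28) 10 ⟩
    C ^ 14 * 10 * n ^ 28              ≤⟨ ℕ.*-monoˡ-≤ (n ^ 28) (ℕ.m≤m+n (C ^ 14 * 10) 1) ⟩
    (C ^ 14 * 10 + 1) * n ^ 28        ∎

-- On a line that is not rich, 2 N i ≤ n², i.e. i is at most half of the average
-- n² / N over N parallel lines covering A × A.
poor-arith : ∀ c {n N i} → N ^ 8 ≤ c * n ^ 15 → (c * 2 ^ 8 + 4) * i ^ 8 < n → 2 * N * i ≤ n * n
poor-arith c {n} {N} {i} N⁸≤ poor = pow-cancel-≤ 8 (begin
  (2 * N * i) ^ 8                    ≡⟨ ≡.trans (^-distribʳ-* (2 * N) i 8) (≡.cong (_* i ^ 8) (^-distribʳ-* 2 N 8)) ⟩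
  2 ^ 8 * N ^ 8 * i ^ 8              ≤⟨ ℕ.*-monoˡ-≤ (i ^ 8) (ℕ.*-monoʳ-≤ (2 ^ 8) N⁸≤) ⟩
  2 ^ 8 * (c * n ^ 15) * i ^ 8       ≡⟨ lem (2 ^ 8) c (n ^ 15) (i ^ 8) ⟩
  c * 2 ^ 8 * i ^ 8 * n ^ 15         ≤⟨ ℕ.*-monoˡ-≤ (n ^ 15) (ℕ.*-monoˡ-≤ (i ^ 8) (ℕ.m≤m+n (c * 2 ^ 8) 4)) ⟩
  (c * 2 ^ 8 + 4) * i ^ 8 * n ^ 15   ≤⟨ ℕ.*-monoˡ-≤ (n ^ 15) (ℕ.<⇒≤ poor) ⟩
  n * n ^ 15                         ≡⟨ ℕ.^-distribˡ-+-* n 8 8 ⟩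
  n ^ 8 * n ^ 8                      ≡⟨ ^-distribʳ-* n n 8 ⟨
  (n * n) ^ 8                        ∎)
  where
  open ℕ.≤-Reasoning
  lem : ∀ i c j k → i * (c * j) * k ≡ c * i * k * j
  lem = solve-∀

-- The reason for the summand 4 in the final constant: for sets of at most three elements a single
-- incidence is rich enough.
small-arith : ∀ k n i → n ≤ 3 → 1 ≤ i → n ≤ (k * 2 ^ 8 + 4) * i ^ 8
small-arith k n i n≤3 1≤i = ℕ.≤-trans n≤3 (ℕ.*-mono-≤ {3} {k * 2 ^ 8 + 4} {1} {i ^ 8}
  (ℕ.≤-trans (ℕ.n≤1+n 3) (ℕ.m≤n+m 4 (k * 2 ^ 8))) (ℕ.m^n>0 i {{ℕ.>-nonZero 1≤i}} 8))

-- Rich lines of slope 1.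

module Lines {c ℓ₁ ℓ₂} (ℝ : Reals c ℓ₁ ℓ₂) where
  open OrderedField ℝ
  open RingProperties (Reals.ring ℝ) using (-1*x≈-x)
  open Plane ℝ using (Point; Line; On; on?; NonTrivial; SameLine; Distinct; incidences; Δ)

  1≉0 : 1# ≉ 0#
  1≉0 = 0≉1 ∘ ≈-sym

  slope-1 : Carrier → Line
  slope-1 d = record { a = 1# ; b = - 1# ; d = d ; nondegenerate = 1≉0 ∘ proj₁ }

  -- For very small `A` the lines of slope 1 may fail: with one element the only grid point is on
  -- the diagonal. A line of slope -1 is non-trivial for every `d` and can pass through `(a , a)`.
  slope--1 : Carrier → Line
  slope--1 d = record { a = 1# ; b = 1# ; d = d ; nondegenerate = 1≉0 ∘ proj₁ }

  slope-1-lhs : ∀ x y → 1# *ᴿ x +ᴿ - 1# *ᴿ y ≈ x -ᴿ y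
  slope-1-lhs x y = +-cong (*-identityˡ x) (-1*x≈-x y)

  slope-1-through : ∀ {x y d} → d ≈ x -ᴿ y → On (slope-1 d) (x , y)
  slope-1-through {x} {y} d≈ = ≈-trans (slope-1-lhs x y) (≈-sym d≈)

  slope-1-difference : ∀ {x y d} → On (slope-1 d) (x , y) → x -ᴿ y ≈ d
  slope-1-difference {x} {y} on = ≈-trans (≈-sym (slope-1-lhs x y)) on

  slope-1-nonTrivial : ∀ {d} → d ≉ 0# → NonTrivial (slope-1 d)
  slope-1-nonTrivial {d} d≉0 = 1≉0 , -1≉0 , λ (_ , diagonal⊆) →
    d≉0 (≈-trans (≈-sym (slope-1-difference (diagonal⊆ {0# , 0#} ≈-refl))) (-‿inverseʳ 0#))
    where
    -1≉0 : - 1# ≉ 0#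
    -1≉0 -1≈0 = 1≉0 (≈-trans (≈-sym (+-identityʳ 1#)) (≈-trans (+-congˡ (≈-sym -1≈0)) (-‿inverseʳ 1#)))

  slope--1-nonTrivial : ∀ d → NonTrivial (slope--1 d)
  slope--1-nonTrivial d = 1≉0 , 1≉0 , λ (_ , diagonal⊆) →
    irrefl (≈-trans (≈-sym (lhs 0#)) (≈-trans (diagonal⊆ {0# , 0#} ≈-refl)
                    (≈-trans (≈-sym (diagonal⊆ {1# , 1#} ≈-refl)) (lhs 1#))))
           (<-respˡ-≈ (≈-sym (+-identityˡ 0#)) 0<2)
    where
    lhs : ∀ x → 1# *ᴿ x +ᴿ 1# *ᴿ x ≈ x +ᴿ x
    lhs x = +-cong (*-identityˡ x) (*-identityˡ x)

  slope-1-injective : ∀ {d d′} → SameLine (slope-1 d) (slope-1 d′) → d ≈ d′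
  slope-1-injective {d} {d′} (l⊆l′ , _) = ≈-trans (≈-sym d-0)
    (slope-1-difference {d} {0#} (l⊆l′ {d , 0#} (slope-1-through (≈-sym d-0))))
    where
    d-0 : d -ᴿ 0# ≈ d
    d-0 = ≈-sub (≈-sym (+-identityʳ d))

  slope--1-incident : ∀ a A → 1 ≤ incidences (slope--1 (a +ᴿ a)) (a ∷ A)
  slope--1-incident a A = filter-some (on? (slope--1 (a +ᴿ a)))
    (here {xs = map (a ,_) A ++ cartesianProduct A (a ∷ A)} (+-cong (*-identityˡ a) (*-identityˡ a)))

  module _ (A : List Carrier) (A! : Unique A) where
    open Distances ℝ A using (D; differences; sub-cong; squares-bound; length-differences)
    open Sumset +-abelianGroup _≟_

    private
      n N : ℕ
      n = length A
      N = length differences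

      P : List Point
      P = cartesianProduct A A

    differences-bound : ∀ C → 0 < n → length (Δ P) ≤ C * n ^ 2 →
                        N ^ 8 ≤ ((C ^ 14 * 10 + 1) * 4 ^ 15) ^ 8 * n ^ 15
    differences-bound C 0<n few = differences-arith C (length D) 0<n few squares-bound length-differences

    total-incidences : n * n ≤ ∑ differences (λ d → incidences (slope-1 d) A)
    total-incidences = begin
      n * n                                                        ≡⟨ length-cartesianProduct A A ⟨
      length P                                                     ≡⟨ ℕ.*-identityʳ _ ⟨
      length P * 1                                                 ≡⟨ ∑-const P 1 ⟨
      ∑ P (λ _ → 1)                                                ≤⟨ ∑-mono (All.map covered (All-cartesianProduct (All-∈ {xs = A} id) (All-∈ {xs = A} id))) ⟩
      ∑ P (λ p → count (λ d → on? (slope-1 d) p) differences)      ≡⟨ ∑-count (λ d → on? (slope-1 d)) differences P ⟨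
      ∑ differences (λ d → incidences (slope-1 d) A)               ∎
      where
      open ℕ.≤-Reasoning
      covered : ∀ {p} → proj₁ p ∈ A × proj₂ p ∈ A → 1 ≤ count (λ d → on? (slope-1 d) p) differences
      covered {x , y} (x∈ , y∈) = filter-some (λ d → on? (slope-1 d) (x , y))
        (Any.map (λ x-y≈d → slope-1-through (≈-sym x-y≈d))
          (∈-dedup⁺ (Membership.∈-cartesianProductWith⁺ setoid setoid setoid sub-cong x∈ y∈)))

    incidences≤n : ∀ d → incidences (slope-1 d) A ≤ n
    incidences≤n d = Pairs.pigeonhole {R = Projects} Projects-injective
      (Unique.filter⁺ (Pointwise.×-setoid setoid setoid) (on? (slope-1 d)) (Unique.cartesianProduct⁺ setoid setoid A! A!))
      (All.map (λ ((x∈ , _) , on) → Any.map (λ x≈ → on , x≈) x∈)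
        (All-filter (on? (slope-1 d)) (All-cartesianProduct (All-∈ {xs = A} id) (All-∈ {xs = A} id))))
      where
      module Pairs = Pigeonhole (Pointwise.×-setoid setoid setoid)
      Projects : Point → Carrier → Set _
      Projects p x = On (slope-1 d) p × proj₁ p ≈ x
      Projects-injective : ∀ {p q x} → Projects p x → Projects q x → Pointwise.Pointwise _≈_ _≈_ p q
      Projects-injective {x , y} {x′ , y′} (on , x≈) (on′ , x′≈) = x≈x′ , neg-injective
        (+-cancelʳ x (≈-trans (+-comm (- y) x) (≈-trans (slope-1-difference on)
          (≈-trans (≈-sym (slope-1-difference on′)) (≈-trans (+-comm x′ (- y′)) (+-congˡ (≈-sym x≈x′)))))))
        where
        x≈x′ : x ≈ x′
        x≈x′ = ≈-trans x≈ (≈-sym x′≈)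

    module _ (k : ℕ) (N⁸≤ : N ^ 8 ≤ k * n ^ 15) (0<n : 0 < n) where

      -- The 8th power of 2 reflects that a poor line has at most half the average number of points.
      K : ℕ
      K = k * 2 ^ 8 + 4

      Rich : Line → Set
      Rich l = n ≤ K * incidences l A ^ 8

      rich? : Decidable (Rich ∘ slope-1)
      rich? d = n ℕ.≤? K * incidences (slope-1 d) A ^ 8

      many-rich : n ≤ 2 * count rich? differences
      many-rich = ℕ.*-cancelˡ-≤ (N * n) {{ℕ.m*n≢0 N n}} (ℕ.+-cancelˡ-≤ (N * (n * n)) _ _ (begin
        N * (n * n) + N * n * n                                       ≡⟨ lem₁ N n ⟩
        2 * N * (n * n)                                               ≤⟨ ℕ.*-monoʳ-≤ (2 * N) total-incidences ⟩
        2 * N * ∑ differences (λ d → incidences (slope-1 d) A)        ≤⟨ ∑-popular rich? (λ d → incidences (slope-1 d) A) (2 * N) (n * n) n differences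
                                                                           (All.universal incidences≤n differences)
                                                                           (All.universal (λ d poor → poor-arith k {n} {N} N⁸≤ (ℕ.≰⇒> poor)) differences) ⟩
        N * (n * n) + count rich? differences * (2 * N * n)           ≡⟨ ≡.cong (N * (n * n) +_) (lem₂ (count rich? differences) N n) ⟩
        N * (n * n) + N * n * (2 * count rich? differences)           ∎))
        where
        open ℕ.≤-Reasoning
        lem₁ : ∀ N n → N * (n * n) + N * n * n ≡ 2 * N * (n * n)
        lem₁ = solve-∀
        lem₂ : ∀ r N n → r * (2 * N * n) ≡ N * n * (2 * r)
        lem₂ = solve-∀
        instance
          n≢0 : NonZero n
          n≢0 = ℕ.>-nonZero 0<n
          N≢0 : NonZero N
          N≢0 = ℕ.>-nonZero (ℕ.n≢0⇒n>0 (λ N≡0 → ℕ.<⇒≱ (ℕ.*-mono-≤ 0<n 0<n)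
            (ℕ.≤-trans total-incidences (ℕ.≤-trans (∑-≤-const (All.universal incidences≤n differences))
              (ℕ.≤-reflexive (≡.cong (_* n) N≡0))))))

      -- Half of `n` bounds the number of rich differences from below; the `1 +` makes up for the
      -- difference zero, whose line is the excluded diagonal.
      rich-lines : ∃[ L ] (n ≤ 2 * (1 + length L) × AllPairs Distinct L × All (λ l → NonTrivial l × Rich l) L)
      rich-lines = map slope-1 ds , length≤ , AllPairs.map⁺ (AllPairs.map (λ d≉d′ → d≉d′ ∘ slope-1-injective) ds!) ,
                   All.map⁺ (All.map (λ (rich , d≉0) → slope-1-nonTrivial d≉0 , rich)
                     (All-filter (λ d → ¬? (d ≟ 0#)) (All.all-filter rich? differences)))
        where
        open ℕ.≤-Reasoning
        rs ds : List Carrier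
        rs = filter rich? differences
        ds = filter (λ d → ¬? (d ≟ 0#)) rs
        rs! : Unique rs
        rs! = Unique.filter⁺ setoid rich? (dedup-! (cartesianProductWith _-ᴿ_ A A))
        ds! : Unique ds
        ds! = Unique.filter⁺ setoid (λ d → ¬? (d ≟ 0#)) rs!
        length≤ : n ≤ 2 * (1 + length (map slope-1 ds))
        length≤ = begin
          n                                       ≤⟨ many-rich ⟩
          2 * length rs                           ≤⟨ ℕ.*-monoʳ-≤ 2 (count-∁ (_≟ 0#) (λ d → ¬? (d ≟ 0#)) id rs) ⟩
          2 * (count (_≟ 0#) rs + length ds)      ≤⟨ ℕ.*-monoʳ-≤ 2 (ℕ.+-mono-≤ (count-≤-1 (_≟ 0#) (λ x≈0 y≈0 → ≈-trans x≈0 (≈-sym y≈0)) rs!)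
                                                       (ℕ.≤-reflexive (≡.sym (length-map slope-1 ds)))) ⟩
          2 * (1 + length (map slope-1 ds))       ∎

  module _ (C k : ℕ) (bound : ∀ A → Unique A → 0 < length A → length (Δ (cartesianProduct A A)) ≤ C * length A ^ 2 →
                              length (Distances.differences ℝ A) ^ 8 ≤ k * length A ^ 15) where

    RichLine : List Carrier → Line → Set _
    RichLine A l = NonTrivial l × length A ≤ (k * 2 ^ 8 + 4) * incidences l A ^ 8

    many-lines : ∀ M (A : List Carrier) → Unique A → 2 * (1 + M) ≤ length A →
                 length (Δ (cartesianProduct A A)) ≤ C * length A ^ 2 →
                 ∃[ L ] (M ≤ length L × AllPairs Distinct L × All (RichLine A) L)
    many-lines M A A! large few = conclude (rich-lines A A! k (bound A A! 0<n few) 0<n)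
      where
      0<n : 0 < length A
      0<n = ℕ.<-≤-trans (s≤s z≤n) large
      conclude : ∃[ L ] (length A ≤ 2 * (1 + length L) × AllPairs Distinct L × All (RichLine A) L) →
                 ∃[ L ] (M ≤ length L × AllPairs Distinct L × All (RichLine A) L)
      conclude (L , n≤ , distinct , rich) = L , ℕ.s≤s⁻¹ (ℕ.*-cancelˡ-≤ 2 (ℕ.≤-trans large n≤)) , distinct , rich

    one-line-small : ∀ A → length A ≤ 3 → ∃[ l ] RichLine A l
    one-line-small []      _   = slope--1 0# , slope--1-nonTrivial 0# , z≤n
    one-line-small (a ∷ A) n≤3 = slope--1 (a +ᴿ a) , slope--1-nonTrivial (a +ᴿ a) ,
      small-arith k (suc (length A)) (incidences (slope--1 (a +ᴿ a)) (a ∷ A)) n≤3 (slope--1-incident a A)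

    one-line : ∀ (A : List Carrier) → Unique A → length (Δ (cartesianProduct A A)) ≤ C * length A ^ 2 →
               ∃[ l ] RichLine A l
    -- Four is the size 2 (1 + 1) from which `many-lines` guarantees one line.
    one-line A A! few = [ (λ large → head (many-lines 1 A A! large few)) , (λ { (s≤s n≤3) → one-line-small A n≤3 }) ]′
                        (ℕ.≤-<-connex 4 (length A))
      where
      head : ∃[ L ] (1 ≤ length L × AllPairs Distinct L × All (RichLine A) L) → ∃[ l ] RichLine A l
      head (l ∷ _ , _ , _ , rich ∷ _) = l , rich

    rich-lines-exist :
      ∃[ K ]
        ( ( (A : List Carrier) → Unique A →
            length (Δ (cartesianProduct A A)) ≤ C * length A ^ 2 →
            ∃[ l ] (NonTrivial l × length A ≤ K * incidences l A ^ 8) )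
        × ( (M : ℕ) → ∃[ N ]
            ( (A : List Carrier) → Unique A → N ≤ length A →
              length (Δ (cartesianProduct A A)) ≤ C * length A ^ 2 →
              ∃[ L ]
                ( M ≤ length L
                × AllPairs Distinct L
                × All (λ l → NonTrivial l × length A ≤ K * incidences l A ^ 8) L ) ) ) )
    rich-lines-exist = k * 2 ^ 8 + 4 , one-line , λ M → 2 * (1 + M) , many-lines M

mainTheorem2 : ∀ {c ℓ₁ ℓ₂} (ℝ : Reals c ℓ₁ ℓ₂) →
    let open Reals ℝ using (Carrier)
        open Plane ℝ
    in
    (C : ℕ) →
    ∃[ K ]
      ( ( (A : List Carrier) → Unique A →
          length (Δ (cartesianProduct A A)) ≤ C * length A ^ 2 →
          ∃[ l ] (NonTrivial l × length A ≤ K * incidences l A ^ 8) )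
      × ( (M : ℕ) → ∃[ N ]
          ( (A : List Carrier) → Unique A → N ≤ length A →
            length (Δ (cartesianProduct A A)) ≤ C * length A ^ 2 →
            ∃[ L ]
              ( M ≤ length L
              × AllPairs Distinct L
              × All (λ l → NonTrivial l × length A ≤ K * incidences l A ^ 8) L ) ) ) )
-- The constant is that of `differences-arith` and depends on `C` alone.
mainTheorem2 ℝ C = rich-lines-exist C (((C ^ 14 * 10 + 1) * 4 ^ 15) ^ 8) (λ A A! → differences-bound A A! C)
  where open Lines ℝ
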